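{- For all integers $n \geq 2$ and $k \geq 3$, the measure rings $\Theta(C_n\mathfrak{T})$ and $\Theta(C_n\mathfrak{T}_k)$ are both isomorphic to the zero ring. Consequently there are no ($\mathbb{C}$-valued) measures on $C_n\mathfrak{T}$ or on $C_n\mathfrak{T}_k$.
   Context: A structure is a set with a family of relations; an embedding is an injective map that is an isomorphism onto the induced substructure on its image. Given embeddings $i:W\to X$, $j:W\to Y$, an amalgamation of $X$ and $Y$ over $W$ is a structure $Z$ with jointly surjective embeddings $j':X\to Z$, $i':Y\to Z$ such that $i'\circ j=j'\circ i$; amalgamations are taken up to isomorphism compatible with these maps. A Fraïssé class is a class $\mathfrak{F}$ of finite structures closed under isomorphism and substructures, having finitely many isomorphism classes of each size, and such that for all $X,Y\in\mathfrak{F}$ and embeddings of a common $W\in\mathfrak{F}$ (possibly empty) into them, some amalgamation of $X,Y$ over $W$ lies in $\mathfrak{F}$. The measure ring $\Theta(\mathfrak{F})$ is the commutative ring generated by symbols $[i]$, one for each embedding $i$ in $\mathfrak{F}$, subject to: $[i]=1$ if $i$ is an isomorphism; $[j\circ i]=[j][i]$ for composable embeddings; and for embeddings $i:W\to X$, $j:W\to Y$, $[i]=\sum_{k=1}^m [i'_k]$ where $Z_1,\dots,Z_m$ are all the amalgamations of $X$ and $Y$ over $W$ lying in $\mathfrak{F}$ and $i'_k:Y\to Z_k$ the corresponding embeddings. A measure on $\mathfrak{F}$ is a $\mathbb{C}$-valued function on embeddings satisfying the same three rules, equivalently a ring homomorphism $\Theta(\mathfrak{F})\to\mathbb{C}$.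 For a finite tree $T$ with leaf set $L(T)$, let $R$ be the quartic relation on $L(T)$ with $R(a,b;c,d)$ true iff $a,b,c,d$ are distinct and the simple path from $a$ to $b$ is disjoint from the simple path from $c$ to $d$. An $n$-colored tree structure is $L(T)$ equipped with $R$ and a coloring $\sigma:L(T)\to\{1,\dots,n\}$ (given as unary relations). $C_n\mathfrak{T}$ is the class of all structures isomorphic to $n$-colored tree structures, and $C_n\mathfrak{T}_k$ is the subclass coming from trees all of whose vertices have degree at most $k$ (trees may be taken reduced, i.e. without degree-two vertices). These are Fraïssé classes. -}

module Defs where

open import Level using (0ℓ)
open import Data.Nat using (ℕ; zero; suc; _≤_)
open import Data.Bool using (Bool; true; false; if_then_else_)
open import Data.Fin using (Fin)
import Data.Fin as Fin
open import Data.Vec using (Vec; lookup; map)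
open import Data.Nat.ListAction using (sum)
open import Data.List using (List; []; _∷_; allFin) renaming (map to lmap)
open import Data.List.Membership.Propositional using (_∈_)
open import Data.List.Relation.Unary.Unique.Propositional using (Unique)
open import Data.Product using (Σ; ∃; _×_; _,_)
open import Data.Sum using (_⊎_)
open import Data.Empty using (⊥)
open import Relation.Nullary using (¬_)
open import Relation.Binary.PropositionalEquality using (_≡_)
open import Function.Bundles using (_⇔_)
open import Algebra.Bundles using (CommutativeRing)

-- Finite structures in the signature {R (quartic)} ∪ {n unary colour
-- predicates}.  The underlying set is Fin size; the colour predicates
-- are given as a colouring function (each point has exactly one colour).

record Str (n : ℕ) : Set where
  constructor mkStr
  field
    size : ℕ
    rel  : Fin size → Fin size → Fin size → Fin size → Bool
    col  : Fin size → Fin n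
open Str public

-- maps of underlying sets, represented as vectors (so that equality of
-- maps is decidable/extensional)
Map : ∀ {n} → Str n → Str n → Set
Map X Y = Vec (Fin (size Y)) (size X)

comp : ∀ {n} (X Y Z : Str n) → Map Y Z → Map X Y → Map X Z
comp X Y Z g f = map (lookup g) f

IsEmb : ∀ {n} (X Y : Str n) → Map X Y → Set
IsEmb X Y f =
  (∀ a b → lookup f a ≡ lookup f b → a ≡ b)
  × (∀ a b c d → rel Y (lookup f a) (lookup f b) (lookup f c) (lookup f d)
                   ≡ rel X a b c d)
  × (∀ a → col Y (lookup f a) ≡ col X a)

IsIso : ∀ {n} (X Y : Str n) → Map X Y → Set
IsIso X Y f = IsEmb X Y f × (∀ y → ∃ λ x → lookup f x ≡ y)

record Amalg {n} (W X Y : Str n) (i : Map W X) (j : Map W Y) : Set where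
  field
    Z     : Str n
    f     : Map X Z
    g     : Map Y Z
    f-emb : IsEmb X Z f
    g-emb : IsEmb Y Z g
    joint : ∀ z → (∃ λ x → lookup f x ≡ z) ⊎ (∃ λ y → lookup g y ≡ z)
    comm  : ∀ w → lookup g (lookup j w) ≡ lookup f (lookup i w)
open Amalg public

AmalgIso : ∀ {n} (W X Y : Str n) (i : Map W X) (j : Map W Y)
           → Amalg W X Y i j → Amalg W X Y i j → Set
AmalgIso W X Y i j A B =
  Σ (Map (Z A) (Z B)) λ h →
    IsIso (Z A) (Z B) h
    × (∀ x → lookup h (lookup (f A) x) ≡ lookup (f B) x)
    × (∀ y → lookup h (lookup (g A) y) ≡ lookup (g B) y)

IsRepSystem : ∀ {n} (F : Str n → Set) (W X Y : Str n) (i : Map W X) (j : Map W Y)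
              (N : ℕ) → (Fin N → Amalg W X Y i j) → Set
IsRepSystem F W X Y i j N reps =
  (∀ k → F (Z (reps k)))
  × (∀ (A : Amalg W X Y i j) → F (Z A) → ∃ λ k → AmalgIso W X Y i j A (reps k))
  × (∀ (A : Amalg W X Y i j) k k' → AmalgIso W X Y i j A (reps k)
       → AmalgIso W X Y i j A (reps k') → k ≡ k')

-- Measures with values in a commutative ring R on a class F.
-- Θ(F) is the zero ring iff for every commutative ring R every
-- R-valued measure forces 1 ≈ 0 in R (universal property of Θ(F)).

module _ {n : ℕ} (F : Str n → Set) (R : CommutativeRing 0ℓ 0ℓ) where
  open CommutativeRing R

  ΣR : ∀ {N} → (Fin N → Carrier) → Carrier
  ΣR {zero}  h = 0#
  ΣR {suc N} h = h Fin.zero + ΣR (λ k → h (Fin.suc k))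

  IsMeasure : ((X Y : Str n) → Map X Y → Carrier) → Set
  IsMeasure μ =
    (∀ X Y (i : Map X Y) → F X → F Y → IsIso X Y i → μ X Y i ≈ 1#)
    × (∀ X Y Z (i : Map X Y) (j : Map Y Z) → F X → F Y → F Z
         → IsEmb X Y i → IsEmb Y Z j → μ X Z (comp X Y Z j i) ≈ μ Y Z j * μ X Y i)
    × (∀ W X Y (i : Map W X) (j : Map W Y) → F W → F X → F Y
         → IsEmb W X i → IsEmb W Y j
         → ∀ N (reps : Fin N → Amalg W X Y i j) → IsRepSystem F W X Y i j N reps
         → μ W X i ≈ ΣR (λ k → μ Y (Z (reps k)) (g (reps k))))

ThetaTrivial : ∀ {n} → (Str n → Set) → Set₁
ThetaTrivial {n} F =
  (R : CommutativeRing 0ℓ 0ℓ) (μ : (X Y : Str n) → Map X Y → CommutativeRing.Carrier R)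
  → IsMeasure F R μ → CommutativeRing._≈_ R (CommutativeRing.1# R) (CommutativeRing.0# R)

Graph : ℕ → Set
Graph v = Fin v → Fin v → Bool

data Walk {v} (G : Graph v) : Fin v → Fin v → List (Fin v) → Set where
  here : ∀ a → Walk G a a (a ∷ [])
  step : ∀ a b c p → G a b ≡ true → Walk G b c p → Walk G a c (a ∷ p)

SimplePath : ∀ {v} → Graph v → Fin v → Fin v → List (Fin v) → Set
SimplePath G a b p = Walk G a b p × Unique p

IsTree : ∀ {v} → Graph v → Set
IsTree G =
  (∀ a b → G a b ≡ G b a)
  × (∀ a → G a a ≡ false)
  × (∀ a b → ∃ λ p → SimplePath G a b p)
  × (∀ a b p q → SimplePath G a b p → SimplePath G a b q → p ≡ q)

deg : ∀ {v} → Graph v → Fin v → ℕ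
deg {v} G u = sum (lmap (λ w → if G u w then 1 else 0) (allFin v))

-- leaves: vertices of degree ≤ 1 (so a one-vertex tree has one leaf)
IsLeaf : ∀ {v} → Graph v → Fin v → Set
IsLeaf G u = deg G u ≤ 1

Disjoint : ∀ {v} → List (Fin v) → List (Fin v) → Set
Disjoint p q = ∀ x → x ∈ p → x ∈ q → ⊥

Distinct4 : ∀ {m} → Fin m → Fin m → Fin m → Fin m → Set
Distinct4 a b c d =
  ¬ a ≡ b × ¬ a ≡ c × ¬ a ≡ d × ¬ b ≡ c × ¬ b ≡ d × ¬ c ≡ d

-- X is isomorphic to the n-coloured tree structure of the tree G,
-- via ℓ : Fin (size X) → Fin v, a bijection onto the leaves L(G).
-- (The colouring of X is arbitrary, transported along ℓ.)
record TreeRealisation {n} (X : Str n) {v : ℕ} (G : Graph v) : Set where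
  field
    tree   : IsTree G
    ℓ      : Fin (size X) → Fin v
    ℓ-inj  : ∀ a b → ℓ a ≡ ℓ b → a ≡ b
    ℓ-leaf : ∀ a → IsLeaf G (ℓ a)
    ℓ-onto : ∀ u → IsLeaf G u → ∃ λ a → ℓ a ≡ u
    ℓ-rel  : ∀ a b c d →
      (rel X a b c d ≡ true)
      ⇔ (Distinct4 a b c d
         × (∀ p q → SimplePath G (ℓ a) (ℓ b) p → SimplePath G (ℓ c) (ℓ d) q
                  → Disjoint p q))

CT : (n : ℕ) → Str n → Set
CT n X = Σ ℕ λ v → Σ (Graph v) λ G → TreeRealisation X G

CTk : (n k : ℕ) → Str n → Set
CTk n k X = Σ ℕ λ v → Σ (Graph v) λ G → TreeRealisation X G × (∀ u → deg G u ≤ k)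

module Submission where

-- Write [i] for the value of a measure on i, and fix colours c ≠ c′. For tripods abc the value x(a, e) of adding
-- a leaf of colour e on the edge at a, and the value y(e) of adding it at the centre, depend only on a and e.
-- Comparing amalgamations of abe with abd over ab shows that x(d, e) + δ(d, e) =: s(e) does not depend on d;
-- comparing those of two tripods over abc gives the value −s(e) − y(e) for the inner edge of a quartet.
-- Adding d and e to abc on the edge at a, in either order, gives x(a, e) (x(a, d) + s(d) + y(d)) = 0, and the
-- four choices of a, e ∈ {c, c′} imply s(c) + s(c′) = 1. Adding d and e to ab to form the quartet de|ab,
-- in either order, gives [ab → abd] x(d, e) = [ab → abe] x(e, d), and this implies s(c) + s(c′) = 0. Hence 1 = 0.

open import Defs
open import Level using (0ℓ)
open import Algebra.Bundles using (CommutativeRing)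
import Algebra.Properties.Group as GroupProperties
import Algebra.Solver.Ring.NaturalCoefficients.Default as SemiringSolver
open import Data.Bool using (Bool; true; false; if_then_else_; _∧_; _∨_)
import Data.Bool as Bool
open import Data.Empty using (⊥-elim)
open import Data.Fin using (Fin; zero; suc; #_)
open import Data.Fin.Properties using (_≟_; all?; any?; suc-injective)
open import Data.List using (List; []; _∷_; _++_; length; map)
import Data.List.Membership.DecPropositional as DecMembership
open import Data.List.Membership.Propositional using (_∈_; _∉_; find; lose)
open import Data.List.Membership.Propositional.Properties using (∈-allFin; ∈-map⁺; ∈-map⁻; ∈-++⁺ˡ)
open import Data.List.Relation.Unary.All as All using (All; []; _∷_)
open import Data.List.Relation.Unary.All.Properties using (¬Any⇒All¬; All¬⇒¬Any)
open import Data.List.Relation.Unary.AllPairs using ([]; _∷_)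
open import Data.List.Relation.Unary.Any as Any using (here; there) renaming (_─_ to _∖_)
open import Data.List.Relation.Unary.Unique.Propositional using (Unique)
import Data.List.Relation.Unary.Unique.Propositional.Properties as Unique
open import Data.Nat using (ℕ; zero; suc; _≤_; z≤n; s≤s; _≤?_) renaming (_+_ to _+ℕ_)
open import Data.Nat.ListAction using (sum)
open import Data.Nat.Properties using (≤-refl; ≤-trans; ≤-reflexive; +-mono-≤; 1+n≰n; m≤n⇒m<n∨m≡n)
import Data.Nat.Properties as ℕ
open import Data.Product using (∃; _×_; _,_; proj₁; proj₂)
open import Data.Sum using (_⊎_; inj₁; inj₂; [_,_]′; map₁)
open import Data.Vec using (Vec; []; _∷_; lookup; tabulate)
import Data.Vec as Vec
open import Data.Vec.Properties using (lookup∘tabulate; lookup-map)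
open import Function using (_∘_; id)
open import Function.Bundles using (Equivalence; mk⇔)
import Relation.Binary.Reasoning.Setoid as SetoidReasoning
open import Relation.Binary.PropositionalEquality using (_≡_; _≢_; refl; sym; trans; cong; subst; module ≡-Reasoning)
open import Relation.Nullary using (¬_; Dec; yes; no; does; contradiction; ¬?; _×-dec_; _→-dec_; _⊎-dec_)
open import Relation.Nullary.Decidable using (True; toWitness; map′; dec-true)

-- Paths in trees

private
  module _ {v : ℕ} where
    open DecMembership (_≟_ {v}) public using (_∈?_)

head-∈ : ∀ {v} {G : Graph v} {a b p} → Walk G a b p → a ∈ p
head-∈ (here _)         = here refl
head-∈ (step _ _ _ _ _ _) = here refl

last-∈ : ∀ {v} {G : Graph v} {a b p} → Walk G a b p → b ∈ p
last-∈ (here _)           = here refl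
last-∈ (step _ _ _ _ _ w) = there (last-∈ w)

∉⇒fresh : ∀ {v} {x : Fin v} {p} → x ∉ p → All (x ≢_) p
∉⇒fresh = ¬Any⇒All¬ _

fresh⇒∉ : ∀ {v} {x : Fin v} {p} → All (x ≢_) p → x ∉ p
fresh⇒∉ = All¬⇒¬Any

record Split {v} (G : Graph v) (a x b : Fin v) (p : List (Fin v)) : Set where
  field
    {pre post} : List (Fin v)
    pre-path  : SimplePath G a x pre
    post-path : SimplePath G x b post
    pre-⊆     : ∀ {z} → z ∈ pre → z ∈ p
    post-⊆    : ∀ {z} → z ∈ post → z ∈ p
    meet      : ∀ {z} → z ∈ pre → z ∈ post → z ≡ x

split : ∀ {v} {G : Graph v} {a b x p} → SimplePath G a b p → x ∈ p → Split G a x b p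
split (here a , u) (here refl) = record
  { pre-path = here a , [] ∷ [] ; post-path = here a , u
  ; pre-⊆ = id ; post-⊆ = id ; meet = λ { (here e) _ → e } }
split (step a b c p e w , u) (here refl) = record
  { pre-path = here a , [] ∷ [] ; post-path = step a b c p e w , u
  ; pre-⊆ = λ { (here refl) → here refl } ; post-⊆ = id ; meet = λ { (here e) _ → e } }
split (step a b c p e w , a# ∷ u) (there x∈p) = record
  { pre-path  = step a b _ _ e (proj₁ pre-path) , ∉⇒fresh (λ m → fresh⇒∉ a# (pre-⊆ m)) ∷ proj₂ pre-path
  ; post-path = post-path
  ; pre-⊆     = λ { (here refl) → here refl ; (there m) → there (pre-⊆ m) }
  ; post-⊆    = λ m → there (post-⊆ m)
  ; meet      = λ { (here refl) m → contradiction (post-⊆ m) (fresh⇒∉ a#) ; (there m) m′ → meet m m′ } }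
  where open Split (split (w , u) x∈p)

shorten : ∀ {v} {G : Graph v} {a b p} → Walk G a b p →
          ∃ λ q → SimplePath G a b q × (∀ {z} → z ∈ q → z ∈ p)
shorten (here a) = a ∷ [] , (here a , [] ∷ []) , id
shorten (step a b c p e w) with shorten w
... | q , (w′ , u) , q⊆p with a ∈? q
...   | yes a∈q = let open Split (split (w′ , u) a∈q) in
                  _ , post-path , λ m → there (q⊆p (post-⊆ m))
...   | no  a∉q = a ∷ q , (step a b c q e w′ , ∉⇒fresh a∉q ∷ u) ,
                  λ { (here refl) → here refl ; (there m) → there (q⊆p m) }

join : ∀ {v} {G : Graph v} {a b c p q} → Walk G a b p → Walk G b c q →
       ∃ λ r → Walk G a c r × (∀ {z} → z ∈ r → z ∈ p ⊎ z ∈ q)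
join (here a) w′ = _ , w′ , inj₂
join (step a b c p e w) w′ with join w w′
... | r , w″ , r⊆ = a ∷ r , step a b _ r e w″ ,
      λ { (here refl) → inj₁ (here refl) ; (there m) → map₁ there (r⊆ m) }

turn : ∀ {v} {G : Graph v} → (∀ a b → G a b ≡ G b a) → ∀ {a b p} → Walk G a b p →
       ∃ λ q → Walk G b a q × (∀ {z} → z ∈ q → z ∈ p)
turn s (here a) = _ , here a , id
turn s (step a b c p e w) with turn s w
... | q , w′ , q⊆p with join w′ (step b a a (a ∷ []) (trans (s b a) e) (here a))
...   | r , w″ , r⊆ = r , w″ , λ m → [ there ∘ q⊆p , (λ { (here refl) → there (head-∈ w)
                                          ; (there (here refl)) → here refl }) ]′ (r⊆ m)

module Paths {v} {G : Graph v} (T : IsTree G) where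

  private
    G-sym : ∀ a b → G a b ≡ G b a
    G-sym = proj₁ T

    G-irr : ∀ a → G a a ≢ true
    G-irr a e with trans (sym e) (proj₁ (proj₂ T) a)
    ... | ()

    uniq : ∀ {a b p q} → SimplePath G a b p → SimplePath G a b q → p ≡ q
    uniq = proj₂ (proj₂ (proj₂ T)) _ _ _ _

  geodesic : Fin v → Fin v → List (Fin v)
  geodesic a b = proj₁ (proj₁ (proj₂ (proj₂ T)) a b)

  geodesic-simple : ∀ a b → SimplePath G a b (geodesic a b)
  geodesic-simple a b = proj₂ (proj₁ (proj₂ (proj₂ T)) a b)

  geodesic-unique : ∀ {a b p} → SimplePath G a b p → p ≡ geodesic a b
  geodesic-unique s = uniq s (geodesic-simple _ _)

  infix 4 _∈[_,_]
  _∈[_,_] : Fin v → Fin v → Fin v → Set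
  x ∈[ a , b ] = x ∈ geodesic a b

  ∈-simple : ∀ {a b p x} → SimplePath G a b p → x ∈ p → x ∈[ a , b ]
  ∈-simple s m = subst (_ ∈_) (geodesic-unique s) m

  ∈-walk : ∀ {a b p x} → Walk G a b p → x ∈[ a , b ] → x ∈ p
  ∈-walk w m with shorten w
  ... | q , s , q⊆p = q⊆p (subst (_ ∈_) (sym (geodesic-unique s)) m)

  start : ∀ {a b} → a ∈[ a , b ]
  start = head-∈ (proj₁ (geodesic-simple _ _))

  end : ∀ {a b} → b ∈[ a , b ]
  end = last-∈ (proj₁ (geodesic-simple _ _))

  reversed : ∀ {a b x} → x ∈[ a , b ] → x ∈[ b , a ]
  reversed {a} {b} m with turn G-sym (proj₁ (geodesic-simple b a))
  ... | q , w , q⊆ = q⊆ (∈-walk w m)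

  via : ∀ {a b x} c → x ∈[ a , b ] → x ∈[ a , c ] ⊎ x ∈[ c , b ]
  via {a} {b} c m with join (proj₁ (geodesic-simple a c)) (proj₁ (geodesic-simple c b))
  ... | r , w , r⊆ = r⊆ (∈-walk w m)

  initial : ∀ {a b x z} → x ∈[ a , b ] → z ∈[ a , x ] → z ∈[ a , b ]
  initial m m′ = pre-⊆ (subst (_ ∈_) (sym (geodesic-unique pre-path)) m′)
    where open Split (split (geodesic-simple _ _) m)

  crossing : ∀ {a b x z} → x ∈[ a , b ] → z ∈[ a , x ] → z ∈[ x , b ] → z ≡ x
  crossing m m′ m″ = meet (subst (_ ∈_) (sym (geodesic-unique pre-path)) m′)
                          (subst (_ ∈_) (sym (geodesic-unique post-path)) m″)
    where open Split (split (geodesic-simple _ _) m)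

  before : ∀ {c e u w} → u ∈[ c , e ] → w ∈[ u , e ] → u ∈[ c , w ]
  before {u = u} {w} m m′ with via w m
  ... | inj₁ r = r
  ... | inj₂ r with crossing m′ start r
  ...   | refl = end

  edge : ∀ {x y} → G x y ≡ true → ∀ a → x ∈[ a , y ] ⊎ y ∈[ a , x ]
  edge {x} {y} e a with x ∈? geodesic y a
  ... | yes m = inj₁ (reversed m)
  ... | no ¬m = inj₂ (reversed (∈-simple
            (step x y a _ e (proj₁ (geodesic-simple y a)) , ∉⇒fresh ¬m ∷ proj₂ (geodesic-simple y a))
            (there start)))

  Median : Fin v → Fin v → Fin v → Fin v → Set
  Median a b c m = m ∈[ a , b ] × m ∈[ b , c ] × m ∈[ a , c ]

  median : ∀ a b c → ∃ (Median a b c)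
  median a b c = go (proj₁ (geodesic-simple b c)) id end
    where
    go : ∀ {x p} → Walk G x c p → (∀ {z} → z ∈ p → z ∈[ b , c ]) → x ∈[ a , b ] → ∃ (Median a b c)
    go (here _) p⊆ m = c , m , p⊆ (here refl) , end
    go (step x y _ p e w) p⊆ m with y ∈? geodesic a b
    ... | yes y∈ = go w (p⊆ ∘ there) y∈
    ... | no  y∉ with via a (p⊆ (there (head-∈ w)))
    ...   | inj₁ y∈ba = contradiction (reversed y∈ba) y∉
    ...   | inj₂ y∈ac with edge e a
    ...     | inj₁ x∈ay = x , m , p⊆ (here refl) , initial y∈ac x∈ay
    ...     | inj₂ y∈ax = contradiction (initial m y∈ax) y∉

  infix 4 _∥_
  _∥_ : Fin v × Fin v → Fin v × Fin v → Set
  (a , b) ∥ (c , d) = ∀ x → x ∈[ a , b ] → ¬ x ∈[ c , d ]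

  ∥-exclusive : ∀ {a b c d} → (a , b) ∥ (c , d) → ¬ (a , c) ∥ (b , d)
  ∥-exclusive {a} {b} {c} {d} P Q with median a b c
  ... | m , m∈ab , m∈bc , m∈ac with via d m∈bc
  ...   | inj₁ m∈bd = Q m m∈ac m∈bd
  ...   | inj₂ m∈dc = P m m∈ab (reversed m∈dc)

  meet? : ∀ a b c d → Dec (∃ λ x → x ∈[ a , b ] × x ∈[ c , d ])
  meet? a b c d with Any.any? (_∈? geodesic c d) (geodesic a b)
  ... | yes q = let x , i , j = find q in yes (x , i , j)
  ... | no ¬q = no λ (x , i , j) → ¬q (lose i j)

  ∥-five : ∀ {a b c d} e → (a , b) ∥ (c , d) → (a , b) ∥ (c , e) ⊎ (a , e) ∥ (c , d)
  ∥-five {a} {b} {c} {d} e P with meet? a b c e | meet? a e c d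
  ... | no ¬q | _ = inj₁ λ x i j → ¬q (x , i , j)
  ... | yes _ | no ¬q = inj₂ λ x i j → ¬q (x , i , j)
  ... | yes (u , u∈ab , u∈ce) | yes (w , w∈ae , w∈cd) with via u w∈ae
  ...   | inj₁ w∈au = ⊥-elim (P w (initial u∈ab w∈au) w∈cd)
  ...   | inj₂ w∈ue = ⊥-elim (P u u∈ab (initial w∈cd (before u∈ce w∈ue)))

  ∥-median : ∀ {a b c m d} → Median a b c m → ¬ m ∈[ a , d ] → (a , d) ∥ (b , c)
  ∥-median (m∈ab , m∈bc , m∈ac) m∉ad x x∈ad x∈bc with via _ x∈bc
  ... | inj₁ x∈bm = m∉ad (initial x∈ad (before m∈ab (reversed x∈bm)))
  ... | inj₂ x∈mc = m∉ad (initial x∈ad (before m∈ac x∈mc))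

  hop : ∀ {m a} → m ≢ a → ∃ λ y → G m y ≡ true × y ∈[ m , a ]
  hop {m} {a} m≢a = go (proj₁ (geodesic-simple m a)) id
    where
    go : ∀ {p} → Walk G m a p → (∀ {z} → z ∈ p → z ∈[ m , a ]) → ∃ λ y → G m y ≡ true × y ∈[ m , a ]
    go (here _) _ = contradiction refl m≢a
    go (step _ y _ _ e w) p⊆ = y , e , p⊆ (there (head-∈ w))

  hops-differ : ∀ {m a b} (m≢a : m ≢ a) (m≢b : m ≢ b) → m ∈[ a , b ] → proj₁ (hop m≢a) ≢ proj₁ (hop m≢b)
  hops-differ {m} {b = b} m≢a m≢b m∈ab eq =
    let y , e , y∈ = hop m≢a in
    G-irr m (subst (λ z → G m z ≡ true)
      (crossing m∈ab (reversed y∈) (subst (_∈[ m , b ]) (sym eq) (proj₂ (proj₂ (hop m≢b))))) e)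

-- Quartets of leaves

∈-∖ : ∀ {A : Set} {w z : A} {xs} (m : w ∈ xs) → z ∈ xs → w ≢ z → z ∈ (xs ∖ m)
∈-∖ (here refl) (here refl) w≢z = contradiction refl w≢z
∈-∖ (here refl) (there n)   w≢z = n
∈-∖ (there m)   (here refl) w≢z = here refl
∈-∖ (there m)   (there n)   w≢z = there (∈-∖ m n w≢z)

sum-∖ : ∀ {A : Set} (f : A → ℕ) {w} {xs} (m : w ∈ xs) → f w +ℕ sum (map f (xs ∖ m)) ≡ sum (map f xs)
sum-∖ f (here refl) = refl
sum-∖ f {w} {x ∷ xs} (there m) = begin
  f w +ℕ (f x +ℕ rest)  ≡⟨ ℕ.+-assoc (f w) (f x) rest ⟨
  (f w +ℕ f x) +ℕ rest  ≡⟨ cong (_+ℕ rest) (ℕ.+-comm (f w) (f x)) ⟩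
  (f x +ℕ f w) +ℕ rest  ≡⟨ ℕ.+-assoc (f x) (f w) rest ⟩
  f x +ℕ (f w +ℕ rest)  ≡⟨ cong (f x +ℕ_) (sum-∖ f m) ⟩
  f x +ℕ sum (map f xs) ∎
  where
  open ≡-Reasoning
  rest = sum (map f (xs ∖ m))

length≤sum : ∀ {A : Set} (f : A → ℕ) {ws xs : List A} → Unique ws → All (λ w → 1 ≤ f w) ws →
             (∀ {w} → w ∈ ws → w ∈ xs) → length ws ≤ sum (map f xs)
length≤sum f [] [] _ = z≤n
length≤sum f (w# ∷ u) (1≤ ∷ all) ws⊆ = ≤-trans
  (+-mono-≤ 1≤ (length≤sum f u all (λ m → ∈-∖ (ws⊆ (here refl)) (ws⊆ (there m)) (All.lookup w# m))))
  (≤-reflexive (sum-∖ f (ws⊆ (here refl))))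

neighbours≤deg : ∀ {v} (G : Graph v) u {ws} → Unique ws → All (λ w → G u w ≡ true) ws → length ws ≤ deg G u
neighbours≤deg G u uq all = length≤sum (λ w → if G u w then 1 else 0) uq
  (All.map (λ e → subst (λ b → 1 ≤ (if b then 1 else 0)) (sym e) ≤-refl) all) (λ _ → ∈-allFin _)

record QuartetSystem {n} (X : Str n) : Set where
  private R = λ a b c d → rel X a b c d ≡ true
  field
    distinct  : ∀ {a b c d} → R a b c d → Distinct4 a b c d
    swap      : ∀ {a b c d} → R a b c d → R b a c d
    flip      : ∀ {a b c d} → R a b c d → R c d a b
    exclusive : ∀ {a b c d} → R a b c d → ¬ R a c b d
    five      : ∀ {a b c d e} → e ≢ a → e ≢ c → R a b c d → R a b c e ⊎ R a e c d

Resolved : ∀ {n} → Str n → Set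
Resolved X = ∀ {a b c d} → Distinct4 a b c d →
  rel X a b c d ≡ true ⊎ rel X a c b d ≡ true ⊎ rel X a d b c ≡ true

module _ {n} {X : Str n} {v} {G : Graph v} (t : TreeRealisation X G) where
  open TreeRealisation t
  open Paths tree

  private
    R = λ a b c d → rel X a b c d ≡ true

    L : Fin (size X) × Fin (size X) → Fin (size X) × Fin (size X) → Set
    L (a , b) (c , d) = (ℓ a , ℓ b) ∥ (ℓ c , ℓ d)

    from : ∀ {a b c d} → R a b c d → Distinct4 a b c d × L (a , b) (c , d)
    from r = let D , P = Equivalence.to (ℓ-rel _ _ _ _) r in
      D , P _ _ (geodesic-simple _ _) (geodesic-simple _ _)

    to : ∀ {a b c d} → Distinct4 a b c d → L (a , b) (c , d) → R a b c d
    to D P = Equivalence.from (ℓ-rel _ _ _ _)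
      (D , λ p q s s′ x m m′ → P x (∈-simple s m) (∈-simple s′ m′))

  quartetSystem : QuartetSystem X
  quartetSystem = record
    { distinct  = proj₁ ∘ from
    ; swap      = λ r → let (ab , ac , ad , bc , bd , cd) , P = from r in
        to (ab ∘ sym , bc , bd , ac , ad , cd) λ x → P x ∘ reversed
    ; flip      = λ r → let (ab , ac , ad , bc , bd , cd) , P = from r in
        to (cd , ac ∘ sym , bc ∘ sym , ad ∘ sym , bd ∘ sym , ab) λ x i j → P x j i
    ; exclusive = λ r r′ → ∥-exclusive (proj₂ (from r)) (proj₂ (from r′))
    ; five      = five
    }
    where
    five : ∀ {a b c d e} → e ≢ a → e ≢ c → R a b c d → R a b c e ⊎ R a e c d
    five {a} {b} {c} {d} {e} ea ec r with e ≟ b | e ≟ d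
    ... | yes refl | _        = inj₂ r
    ... | no _     | yes refl = inj₁ r
    ... | no eb    | no ed    = let (ab , ac , ad , bc , bd , cd) , P = from r in
      [ (λ Q → inj₁ (to (ab , ac , ea ∘ sym , bc , eb ∘ sym , ec ∘ sym) Q))
      , (λ Q → inj₂ (to (ea ∘ sym , ac , ad , ec , ed , cd) Q)) ]′ (∥-five (ℓ e) P)

  resolved : (∀ u → deg G u ≤ 3) → Resolved X
  resolved deg≤3 {a} {b} {c} {d} (ab , ac , ad , bc , bd , cd)
    with median (ℓ a) (ℓ b) (ℓ c)
  ... | m , med@(m∈ab , m∈bc , m∈ac)
    with m ∈? geodesic (ℓ a) (ℓ d) | m ∈? geodesic (ℓ b) (ℓ d) | m ∈? geodesic (ℓ c) (ℓ d)
  ... | no m∉ad | _ | _ = inj₂ (inj₂ (to (ad , ab , ac , bd ∘ sym , cd ∘ sym , bc) (∥-median med m∉ad)))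
  ... | yes _ | no m∉bd | _ = inj₂ (inj₁ (to (ac , ab , ad , bc ∘ sym , cd , bd)
          λ x i j → ∥-median (reversed m∈ab , m∈ac , m∈bc) m∉bd x j i))
  ... | yes _ | yes _ | no m∉cd = inj₁ (to (ab , ac , ad , bc , bd , cd)
          λ x i j → ∥-median (reversed m∈ac , m∈ab , reversed m∈bc) m∉cd x j i)
  ... | yes m∈ad | yes m∈bd | yes m∈cd = contradiction
          (neighbours≤deg G m
            ((hops-differ a′ b′ m∈ab ∷ hops-differ a′ c′ m∈ac ∷ hops-differ a′ d′ m∈ad ∷ [])
            ∷ (hops-differ b′ c′ m∈bc ∷ hops-differ b′ d′ m∈bd ∷ [])
            ∷ (hops-differ c′ d′ m∈cd ∷ []) ∷ [] ∷ [])
            (adj a′ ∷ adj b′ ∷ adj c′ ∷ adj d′ ∷ []))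
          (λ 4≤ → 1+n≰n (≤-trans 4≤ (deg≤3 m)))
    where
    adj : ∀ {x} (m≢x : m ≢ x) → G m (proj₁ (hop m≢x)) ≡ true
    adj m≢x = proj₁ (proj₂ (hop m≢x))

    not-inner : ∀ {x y z} → x ≢ y → x ≢ z → ¬ ℓ x ∈[ ℓ y , ℓ z ]
    not-inner {x} {y} {z} x≢y x≢z i = 1+n≰n (≤-trans
      (neighbours≤deg G (ℓ x) {ws = proj₁ (hop y′) ∷ proj₁ (hop z′) ∷ []}
        ((hops-differ y′ z′ i ∷ []) ∷ [] ∷ [])
        (proj₁ (proj₂ (hop y′)) ∷ proj₁ (proj₂ (hop z′)) ∷ []))
      (ℓ-leaf x))
      where
      y′ = x≢y ∘ ℓ-inj x y
      z′ = x≢z ∘ ℓ-inj x z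

    a′ : m ≢ ℓ a
    a′ refl = not-inner ab ac m∈bc
    b′ : m ≢ ℓ b
    b′ refl = not-inner (ab ∘ sym) bc m∈ac
    c′ : m ≢ ℓ c
    c′ refl = not-inner (ac ∘ sym) (bc ∘ sym) m∈ab
    d′ : m ≢ ℓ d
    d′ refl = not-inner (ad ∘ sym) (bd ∘ sym) m∈ab

-- Explicit trees

-- Trees grown from a single vertex: sprout p adds a new vertex zero adjacent to the old vertex p.

data Growth : ℕ → Set where
  seed   : Growth 1
  sprout : ∀ {v} → Fin v → Growth v → Growth (suc v)

graph : ∀ {v} → Growth v → Graph v
graph seed         _       _       = false
graph (sprout p t) zero    zero    = false
graph (sprout p t) zero    (suc b) = does (b ≟ p)
graph (sprout p t) (suc a) zero    = does (a ≟ p)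
graph (sprout p t) (suc a) (suc b) = graph t a b

path : ∀ {v} → Growth v → Fin v → Fin v → List (Fin v)
path seed         a       _       = a ∷ []
path (sprout p t) zero    zero    = zero ∷ []
path (sprout p t) zero    (suc b) = zero ∷ map suc (path t p b)
path (sprout p t) (suc a) zero    = map suc (path t a p) ++ zero ∷ []
path (sprout p t) (suc a) (suc b) = map suc (path t a b)

≟-true : ∀ {v} {a p : Fin v} → does (a ≟ p) ≡ true → a ≡ p
≟-true {a = a} {p} e with a ≟ p
... | yes q = q

graph-sym : ∀ {v} (t : Growth v) a b → graph t a b ≡ graph t b a
graph-sym seed         _       _       = refl
graph-sym (sprout p t) zero    zero    = refl
graph-sym (sprout p t) zero    (suc b) = refl
graph-sym (sprout p t) (suc a) zero    = refl
graph-sym (sprout p t) (suc a) (suc b) = graph-sym t a b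

graph-irrefl : ∀ {v} (t : Growth v) a → graph t a a ≡ false
graph-irrefl seed         _       = refl
graph-irrefl (sprout p t) zero    = refl
graph-irrefl (sprout p t) (suc a) = graph-irrefl t a

zero∉map-suc : ∀ {v} (q : List (Fin v)) → Fin.zero ∉ map Fin.suc q
zero∉map-suc q m with ∈-map⁻ Fin.suc m
... | _ , _ , ()

unique-map-suc : ∀ {v} {q : List (Fin v)} → Unique q → Unique (map Fin.suc q)
unique-map-suc = Unique.map⁺ suc-injective

unique-∷ʳ-zero : ∀ {v} {q : List (Fin v)} → Unique q → Unique (map Fin.suc q ++ Fin.zero ∷ [])
unique-∷ʳ-zero {q = q} u = Unique.++⁺ (unique-map-suc u) ([] ∷ [])
  λ { (m , here refl) → zero∉map-suc q m }

module _ {v} (p : Fin v) (t : Growth v) where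
  private G′ = graph (sprout p t)

  lift-walk : ∀ {a b q} → Walk (graph t) a b q → Walk G′ (suc a) (suc b) (map suc q)
  lift-walk (here a)           = here (suc a)
  lift-walk (step a b c q e w) = step (suc a) (suc b) (suc c) _ e (lift-walk w)

  lift-walk-zero : ∀ {a q} → Walk (graph t) a p q → Walk G′ (suc a) zero (map suc q ++ zero ∷ [])
  lift-walk-zero (here a)           = step (suc a) zero zero _ (dec-true (a ≟ a) refl) (here zero)
  lift-walk-zero (step a b c q e w) = step (suc a) (suc b) zero _ e (lift-walk-zero w)

  lower-suc : ∀ {a b r} → SimplePath G′ (suc a) (suc b) r → ∃ λ q → r ≡ map suc q × SimplePath (graph t) a b q
  lower-suc (here (suc a) , _) = a ∷ [] , refl , here a , [] ∷ []
  lower-suc (step (suc a) (suc x) (suc b) r e w , a# ∷ u) with lower-suc (w , u)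
  ... | q , refl , w′ , u′ = a ∷ q , refl , step a x b q e w′ ,
        ∉⇒fresh (λ m → fresh⇒∉ a# (∈-map⁺ suc m)) ∷ u′
  lower-suc (step (suc a) zero (suc b) _ e (step zero (suc x) _ _ e′ w) , a# ∷ _)
    with ≟-true {a = a} e | ≟-true {a = x} e′
  ... | refl | refl = contradiction (there (head-∈ w)) (fresh⇒∉ a#)

  lower-zero : ∀ {a r} → SimplePath G′ (suc a) zero r →
               ∃ λ q → r ≡ map suc q ++ zero ∷ [] × SimplePath (graph t) a p q
  lower-zero (step (suc a) zero zero _ e (here zero) , _) with ≟-true {a = a} e
  ... | refl = a ∷ [] , refl , here a , [] ∷ []
  lower-zero (step (suc a) zero zero _ e (step zero _ zero _ _ w) , _ ∷ z# ∷ _) =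
    contradiction (last-∈ w) (fresh⇒∉ z#)
  lower-zero (step (suc a) (suc x) zero r e w , a# ∷ u) with lower-zero (w , u)
  ... | q , refl , w′ , u′ = a ∷ q , refl , step a x p q e w′ ,
        ∉⇒fresh (λ m → fresh⇒∉ a# (∈-++⁺ˡ (∈-map⁺ suc m))) ∷ u′

path-simple : ∀ {v} (t : Growth v) a b → SimplePath (graph t) a b (path t a b)
path-simple seed         zero    zero    = here zero , [] ∷ []
path-simple (sprout p t) zero    zero    = here zero , [] ∷ []
path-simple (sprout p t) zero    (suc b) =
  step zero (suc p) (suc b) _ (dec-true (p ≟ p) refl) (lift-walk p t (proj₁ (path-simple t p b))) ,
  ∉⇒fresh (zero∉map-suc _) ∷ unique-map-suc (proj₂ (path-simple t p b))
path-simple (sprout p t) (suc a) zero    =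
  lift-walk-zero p t (proj₁ (path-simple t a p)) , unique-∷ʳ-zero (proj₂ (path-simple t a p))
path-simple (sprout p t) (suc a) (suc b) =
  lift-walk p t (proj₁ (path-simple t a b)) , unique-map-suc (proj₂ (path-simple t a b))

path-unique : ∀ {v} (t : Growth v) {a b r} → SimplePath (graph t) a b r → r ≡ path t a b
path-unique seed (here _ , _) = refl
path-unique (sprout p t) {zero} {zero} (here _ , _) = refl
path-unique (sprout p t) {zero} {zero} (step _ _ _ _ _ w , z# ∷ _) = contradiction (last-∈ w) (fresh⇒∉ z#)
path-unique (sprout p t) {zero} {suc b} (step _ (suc x) _ _ e w , _ ∷ u)
  with ≟-true {a = x} e | lower-suc p t (w , u)
... | refl | q , refl , s = cong (λ r → zero ∷ map suc r) (path-unique t s)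
path-unique (sprout p t) {suc a} {zero} s with lower-zero p t s
... | q , refl , s′ = cong (λ r → map suc r ++ zero ∷ []) (path-unique t s′)
path-unique (sprout p t) {suc a} {suc b} s with lower-suc p t s
... | q , refl , s′ = cong (map suc) (path-unique t s′)

isTree : ∀ {v} (t : Growth v) → IsTree (graph t)
isTree t = graph-sym t , graph-irrefl t , (λ a b → path t a b , path-simple t a b) ,
  λ a b p q s s′ → trans (path-unique t s) (sym (path-unique t s′))

distinct4? : ∀ {m} (a b c d : Fin m) → Dec (Distinct4 a b c d)
distinct4? a b c d = ¬? (a ≟ b) ×-dec ¬? (a ≟ c) ×-dec ¬? (a ≟ d) ×-dec ¬? (b ≟ c) ×-dec ¬? (b ≟ d) ×-dec ¬? (c ≟ d)

disjoint? : ∀ {v} (p q : List (Fin v)) → Dec (Disjoint p q)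
disjoint? p q = map′ (λ all x m → All.lookup all m) (λ D → All.tabulate (λ {x} → D x)) (All.all? (λ x → ¬? (x ∈? q)) p)

module _ {m v} (t : Growth v) (ℓ : Fin m → Fin v) where

  Separated : Fin m → Fin m → Fin m → Fin m → Set
  Separated a b c d = Distinct4 a b c d × Disjoint (path t (ℓ a) (ℓ b)) (path t (ℓ c) (ℓ d))

  separated? : ∀ a b c d → Dec (Separated a b c d)
  separated? a b c d = distinct4? a b c d ×-dec disjoint? _ _

  Realises : ℕ → (Fin m → Fin m → Fin m → Fin m → Bool) → Set
  Realises k r =
    (∀ a b → ℓ a ≡ ℓ b → a ≡ b)
    × (∀ a → IsLeaf (graph t) (ℓ a))
    × (∀ u → IsLeaf (graph t) u → ∃ λ a → ℓ a ≡ u)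
    × (∀ u → deg (graph t) u ≤ k)
    × (∀ a b c d → r a b c d ≡ does (separated? a b c d))

  realises? : ∀ k r → Dec (Realises k r)
  realises? k r =
    (all? λ a → all? λ b → ℓ a ≟ ℓ b →-dec a ≟ b)
    ×-dec (all? λ a → deg (graph t) (ℓ a) ≤? 1)
    ×-dec (all? λ u → deg (graph t) u ≤? 1 →-dec any? λ a → ℓ a ≟ u)
    ×-dec (all? λ u → deg (graph t) u ≤? k)
    ×-dec (all? λ a → all? λ b → all? λ c → all? λ d → r a b c d Bool.≟ does (separated? a b c d))

  realisation : ∀ {k n r} (col : Fin m → Fin n) → Realises k r → TreeRealisation (mkStr m r col) (graph t)
  realisation col (inj , leaf , onto , _ , eq) = record
    { tree = isTree t ; ℓ = ℓ ; ℓ-inj = inj ; ℓ-leaf = leaf ; ℓ-onto = onto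
    ; ℓ-rel = λ a b c d → mk⇔
        (λ e → let D , P = does-true (separated? a b c d) (trans (sym (eq a b c d)) e) in D , λ p q s s′ x i j →
           P x (subst (x ∈_) (path-unique t s) i) (subst (x ∈_) (path-unique t s′) j))
        (λ (D , P) → trans (eq a b c d) (dec-true (separated? a b c d)
           (D , P _ _ (path-simple t _ _) (path-simple t _ _))))
    }
    where
    does-true : ∀ {P : Set} (d : Dec P) → does d ≡ true → P
    does-true (yes p) _ = p

-- One-point extensions

-- r b c d is the value of R(∗, b; c, d), where ∗ is a point to be added.

Profile : ℕ → Set
Profile m = Fin m → Fin m → Fin m → Bool

ext-rel : ∀ {m} → (Fin m → Fin m → Fin m → Fin m → Bool) → Profile m →
          Fin (suc m) → Fin (suc m) → Fin (suc m) → Fin (suc m) → Bool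
ext-rel R r (suc a) (suc b) (suc c) (suc d) = R a b c d
ext-rel R r zero    (suc b) (suc c) (suc d) = r b c d
ext-rel R r (suc a) zero    (suc c) (suc d) = r a c d
ext-rel R r (suc a) (suc b) zero    (suc d) = r d a b
ext-rel R r (suc a) (suc b) (suc c) zero    = r c a b
ext-rel R r _       _       _       _       = false

Ext : ∀ {n} (Y : Str n) → Fin n → Profile (size Y) → Str n
Ext Y e r = mkStr (suc (size Y)) (ext-rel (rel Y) r) λ { zero → e ; (suc y) → col Y y }

rel-cong : ∀ {n} (Z : Str n) {a a′ b b′ c c′ d d′} → a ≡ a′ → b ≡ b′ → c ≡ c′ → d ≡ d′ →
           rel Z a b c d ≡ rel Z a′ b′ c′ d′
rel-cong Z refl refl refl refl = refl

tabulate-emb : ∀ {n} (X Y : Str n) (φ : Fin (size X) → Fin (size Y)) →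
  (∀ a b → φ a ≡ φ b → a ≡ b) → (∀ a b c d → rel Y (φ a) (φ b) (φ c) (φ d) ≡ rel X a b c d) →
  (∀ a → col Y (φ a) ≡ col X a) → IsEmb X Y (tabulate φ)
tabulate-emb X Y φ inj rels cols =
  (λ a b eq → inj a b (trans (sym (at a)) (trans eq (at b))))
  , (λ a b c d → trans (rel-cong Y (at a) (at b) (at c) (at d)) (rels a b c d))
  , (λ a → trans (cong (col Y) (at a)) (cols a))
  where at = lookup∘tabulate φ

old-emb : ∀ {n} (Y : Str n) e r → IsEmb Y (Ext Y e r) (tabulate suc)
old-emb Y e r = tabulate-emb Y (Ext Y e r) suc (λ _ _ → suc-injective) (λ _ _ _ _ → refl) (λ _ → refl)

bool-ext : ∀ {x y} → (x ≡ true → y ≡ true) → (y ≡ true → x ≡ true) → x ≡ y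
bool-ext {false} {false} _ _ = refl
bool-ext {false} {true}  _ g = g refl
bool-ext {true}  {y}     f _ = sym (f refl)

not-true : ∀ {x} → x ≢ true → x ≡ false
not-true {false} _ = refl
not-true {true}  ¬e = contradiction refl ¬e

module _ {n} {Z : Str n} (QZ : QuartetSystem Z) where
  open QuartetSystem QZ

  swap-≡ : ∀ a b c d → rel Z a b c d ≡ rel Z b a c d
  swap-≡ _ _ _ _ = bool-ext swap swap

  flip-≡ : ∀ a b c d → rel Z a b c d ≡ rel Z c d a b
  flip-≡ _ _ _ _ = bool-ext flip flip

  degenerate : ∀ {a b c d} → ¬ Distinct4 a b c d → rel Z a b c d ≡ false
  degenerate ¬D = not-true (¬D ∘ distinct)

  extend-emb : ∀ {Y : Str n} {g z e r} → IsEmb Y Z g → (∀ y → lookup g y ≢ z) → col Z z ≡ e →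
    (∀ a b c → rel Z z (lookup g a) (lookup g b) (lookup g c) ≡ r a b c) → IsEmb (Ext Y e r) Z (z ∷ g)
  extend-emb {Y} {g} {z} {e} {r} (g-inj , g-rel , g-col) z∉g z-col z-rel = inj , rel-eq , col-eq
    where
    k = z ∷ g
    inj : ∀ a b → lookup k a ≡ lookup k b → a ≡ b
    inj zero    zero    _  = refl
    inj zero    (suc b) eq = contradiction (sym eq) (z∉g b)
    inj (suc a) zero    eq = contradiction eq (z∉g a)
    inj (suc a) (suc b) eq = cong suc (g-inj a b eq)
    rel-eq : ∀ a b c d → rel Z (lookup k a) (lookup k b) (lookup k c) (lookup k d) ≡ ext-rel (rel Y) r a b c d
    rel-eq (suc a) (suc b) (suc c) (suc d) = g-rel a b c d
    rel-eq zero    (suc b) (suc c) (suc d) = z-rel b c d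
    rel-eq (suc a) zero    (suc c) (suc d) = trans (swap-≡ _ _ _ _) (z-rel a c d)
    rel-eq (suc a) (suc b) zero    (suc d) = trans (flip-≡ _ _ _ _) (z-rel d a b)
    rel-eq (suc a) (suc b) (suc c) zero    = trans (flip-≡ _ _ _ _) (trans (swap-≡ _ _ _ _) (z-rel c a b))
    rel-eq zero    zero    _       _       = degenerate λ (p , _) → p refl
    rel-eq zero    (suc _) zero    _       = degenerate λ (_ , p , _) → p refl
    rel-eq zero    (suc _) (suc _) zero    = degenerate λ (_ , _ , p , _) → p refl
    rel-eq (suc _) zero    zero    _       = degenerate λ (_ , _ , _ , p , _) → p refl
    rel-eq (suc _) zero    (suc _) zero    = degenerate λ (_ , _ , _ , _ , p , _) → p refl
    rel-eq (suc _) (suc _) zero    zero    = degenerate λ (_ , _ , _ , _ , _ , p) → p refl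
    col-eq : ∀ a → col Z (lookup k a) ≡ col (Ext Y e r) a
    col-eq zero    = z-col
    col-eq (suc a) = g-col a

module _ {n} (S Z : Str n) (k : Map S Z) (k-iso : IsIso S Z k) where
  private
    inj = proj₁ (proj₁ k-iso)
    back : Fin (size Z) → Fin (size S)
    back z = proj₁ (proj₂ k-iso z)

  inverse : Map Z S
  inverse = tabulate back

  inverse-right : ∀ z → lookup k (lookup inverse z) ≡ z
  inverse-right z = trans (cong (lookup k) (lookup∘tabulate back z)) (proj₂ (proj₂ k-iso z))

  inverse-left : ∀ s → lookup inverse (lookup k s) ≡ s
  inverse-left s = inj _ _ (inverse-right (lookup k s))

  inverse-iso : IsIso Z S inverse
  inverse-iso = ((λ a b eq → trans (sym (inverse-right a)) (trans (cong (lookup k) eq) (inverse-right b)))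
    , (λ a b c d → trans (sym (proj₁ (proj₂ (proj₁ k-iso)) _ _ _ _))
                     (rel-cong Z (inverse-right a) (inverse-right b) (inverse-right c) (inverse-right d)))
    , (λ a → trans (sym (proj₂ (proj₂ (proj₁ k-iso)) _)) (cong (col Z) (inverse-right a))))
    , λ s → lookup k s , inverse-left s

-- A complete list of the ways to add to Y a point that induces X over W.

record Profiles {n} (F : Str n → Set) (W : Str n) (d e : Fin n) (r₁ r₀ : Profile (size W)) (N : ℕ) : Set where
  Y = Ext W d r₁
  field
    profile   : Fin N → Profile (suc (size W))
    member    : ∀ k → F (Ext Y e (profile k))
    restricts : ∀ k a b c → profile k (suc a) (suc b) (suc c) ≡ r₀ a b c
    different : ∀ k k′ → (∀ a b c → profile k a b c ≡ profile k′ a b c) → k ≡ k′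
    complete  : ∀ {Z} → F Z → (g : Map Y Z) → IsEmb Y Z g → ∀ z → (∀ y → lookup g y ≢ z) →
      (∀ a b c → rel Z z (lookup g (suc a)) (lookup g (suc b)) (lookup g (suc c)) ≡ r₀ a b c) →
      ∃ λ k → ∀ a b c → rel Z z (lookup g a) (lookup g b) (lookup g c) ≡ profile k a b c

module Extensions {n} {F : Str n → Set} (quartets : ∀ {Z} → F Z → QuartetSystem Z)
  {W : Str n} {d e : Fin n} {r₁ r₀ : Profile (size W)} {N : ℕ}
  (FW : F W) (FX : F (Ext W e r₀)) (FY : F (Ext W d r₁))
  (ps : Profiles F W d e r₁ r₀ N) where

  open Profiles ps

  private
    X = Ext W e r₀
    i : Map W X
    i = tabulate suc
    j : Map W Y
    j = tabulate suc
    suc² : ∀ {m} → Fin m → Fin (suc (suc m))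
    suc² a = suc (suc a)

  new-amalgam : Fin N → Amalg W X Y i j
  new-amalgam k = record
    { Z = Ext Y e (profile k)
    ; f = zero ∷ tabulate suc²
    ; g = tabulate suc
    ; f-emb = extend-emb (quartets (member k)) emb₂
        (λ y eq → contradiction (trans (sym (lookup∘tabulate suc² y)) eq) λ ()) refl
        (λ a b c → trans (rel-cong (Ext Y e (profile k)) (refl {x = zero}) (at a) (at b) (at c)) (restricts k a b c))
    ; g-emb = old-emb Y e (profile k)
    ; joint = λ { zero → inj₁ (zero , refl) ; (suc y) → inj₂ (y , lookup∘tabulate suc y) }
    ; comm = λ w → trans (cong (lookup (tabulate suc)) (lookup∘tabulate suc w))
        (trans (lookup∘tabulate suc (Fin.suc w)) (sym (trans (cong (lookup (zero ∷ tabulate suc²)) (lookup∘tabulate suc w))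
                (lookup∘tabulate suc² w))))
    }
    where
    at : ∀ a → lookup (tabulate suc²) a ≡ suc (suc a)
    at = lookup∘tabulate suc²
    emb₂ : IsEmb W (Ext Y e (profile k)) (tabulate suc²)
    emb₂ = tabulate-emb W (Ext Y e (profile k)) suc² (λ _ _ → suc-injective ∘ suc-injective) (λ _ _ _ _ → refl) (λ _ → refl)

  module _ (A : Amalg W X Y i j) where
    private
      z₀ = lookup (f A) zero
      G  = lookup (g A)

    over-W : ∀ w → lookup (f A) (suc w) ≡ G (suc w)
    over-W w = trans (cong (lookup (f A)) (sym (lookup∘tabulate suc w)))
      (trans (sym (comm A w)) (cong G (lookup∘tabulate suc w)))

    z₀-rel : ∀ a b c → rel (Z A) z₀ (G (suc a)) (G (suc b)) (G (suc c)) ≡ r₀ a b c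
    z₀-rel a b c rewrite sym (over-W a) | sym (over-W b) | sym (over-W c) =
      proj₁ (proj₂ (f-emb A)) zero (suc a) (suc b) (suc c)

    new-representative : F (Z A) → (∀ y → G y ≢ z₀) → ∃ λ k → AmalgIso W X Y i j A (new-amalgam k)
    new-representative FZ z₀∉g with complete FZ (g A) (g-emb A) z₀ z₀∉g z₀-rel
    ... | k , eq = k , inverse S (Z A) K K-iso , inverse-iso S (Z A) K K-iso , on-f , on-g
      where
      S = Ext Y e (profile k)
      K : Map S (Z A)
      K = z₀ ∷ g A
      onto : ∀ z → ∃ λ s → lookup K s ≡ z
      onto z with joint A z
      ... | inj₁ (zero , q)  = zero , q
      ... | inj₁ (suc w , q) = suc (suc w) , trans (sym (over-W w)) q
      ... | inj₂ (y , q)     = suc y , q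
      K-iso : IsIso S (Z A) K
      K-iso = extend-emb (quartets FZ) (g-emb A) z₀∉g (proj₂ (proj₂ (f-emb A)) zero) eq , onto
      on-g : ∀ y → lookup (inverse S (Z A) K K-iso) (G y) ≡ lookup (tabulate suc) y
      on-g y = trans (inverse-left S (Z A) K K-iso (suc y)) (sym (lookup∘tabulate suc y))
      on-f : ∀ x → lookup (inverse S (Z A) K K-iso) (lookup (f A) x) ≡ lookup (f (new-amalgam k)) x
      on-f zero = inverse-left S (Z A) K K-iso zero
      on-f (suc w) = trans (cong (lookup (inverse S (Z A) K K-iso)) (over-W w))
        (trans (inverse-left S (Z A) K K-iso (suc (suc w))) (sym (lookup∘tabulate suc² w)))

    new-profile : ∀ k → AmalgIso W X Y i j A (new-amalgam k) →
      ∀ a b c → rel (Z A) z₀ (G a) (G b) (G c) ≡ profile k a b c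
    new-profile k (h , ((_ , h-rel , _) , _) , h-f , h-g) a b c = trans (sym (h-rel _ _ _ _)) (eq (h-f zero) (at a) (at b) (at c))
      where
      at : ∀ y → lookup h (G y) ≡ suc y
      at y = trans (h-g y) (lookup∘tabulate suc y)
      eq : ∀ {p q r s} → p ≡ zero → q ≡ suc a → r ≡ suc b → s ≡ suc c →
           ext-rel (rel Y) (profile k) p q r s ≡ profile k a b c
      eq refl refl refl refl = refl

    new-not-old : ∀ k → AmalgIso W X Y i j A (new-amalgam k) → ∀ y → G y ≢ z₀
    new-not-old k (h , _ , h-f , h-g) y q
      with trans (sym (h-f zero)) (trans (cong (lookup h) (sym q)) (trans (h-g y) (lookup∘tabulate suc y)))
    ... | ()

    new-unique : ∀ k k′ → AmalgIso W X Y i j A (new-amalgam k) → AmalgIso W X Y i j A (new-amalgam k′) → k ≡ k′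
    new-unique k k′ I I′ = different k k′ λ a b c → trans (sym (new-profile k I a b c)) (new-profile k′ I′ a b c)

    identified : ∀ {y} → G y ≡ z₀ → y ≡ zero × d ≡ e × (∀ a b c → r₁ a b c ≡ r₀ a b c)
    identified {suc w} q with proj₁ (f-emb A) (suc w) zero (trans (over-W w) q)
    ... | ()
    identified {zero} q = refl , trans (sym (proj₂ (proj₂ (g-emb A)) zero)) (trans (cong (col (Z A)) q) (proj₂ (proj₂ (f-emb A)) zero))
      , λ a b c → trans (sym (proj₁ (proj₂ (g-emb A)) zero (suc a) (suc b) (suc c)))
          (trans (rel-cong (Z A) q (refl {x = G (suc a)}) (refl {x = G (suc b)}) (refl {x = G (suc c)})) (z₀-rel a b c))

    old? : Dec (∃ λ y → G y ≡ z₀)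
    old? = any? λ y → G y ≟ z₀

  separate-system : (d ≢ e ⊎ ∃ λ a → ∃ λ b → ∃ λ c → r₁ a b c ≢ r₀ a b c) → IsRepSystem F W X Y i j N new-amalgam
  separate-system diff = member , represent , new-unique
    where
    represent : ∀ A → F (Z A) → ∃ λ k → AmalgIso W X Y i j A (new-amalgam k)
    represent A FZ with old? A
    ... | no ¬q = new-representative A FZ λ y q → ¬q (y , q)
    ... | yes (y , q) = let _ , d≡e , r≡ = identified A q in
          ⊥-elim ([ (λ d≢e → d≢e d≡e) , (λ (a , b , c , r≢) → r≢ (r≡ a b c)) ]′ diff)

  module _ (d≡e : d ≡ e) (r₁≡r₀ : ∀ a b c → r₁ a b c ≡ r₀ a b c) where

    private
      at : ∀ (y : Fin (suc (size W))) → lookup (tabulate id) y ≡ y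
      at = lookup∘tabulate id

    id-emb : IsEmb Y Y (tabulate id)
    id-emb = tabulate-emb Y Y id (λ _ _ → id) (λ _ _ _ _ → refl) (λ _ → refl)

    same-emb : IsEmb X Y (tabulate id)
    same-emb = tabulate-emb X Y id (λ _ _ → id) rels cols
      where
      cols : ∀ a → col Y a ≡ col X a
      cols zero    = d≡e
      cols (suc a) = refl
      rels : ∀ a b c d → rel Y a b c d ≡ rel X a b c d
      rels (suc a) (suc b) (suc c) (suc d) = refl
      rels zero    (suc b) (suc c) (suc d) = r₁≡r₀ b c d
      rels (suc a) zero    (suc c) (suc d) = r₁≡r₀ a c d
      rels (suc a) (suc b) zero    (suc d) = r₁≡r₀ d a b
      rels (suc a) (suc b) (suc c) zero    = r₁≡r₀ c a b
      rels zero    zero    _       _       = refl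
      rels zero    (suc _) zero    _       = refl
      rels zero    (suc _) (suc _) zero    = refl
      rels (suc _) zero    zero    _       = refl
      rels (suc _) zero    (suc _) zero    = refl
      rels (suc _) (suc _) zero    zero    = refl

    amalgams : Fin (suc N) → Amalg W X Y i j
    amalgams zero = record
      { Z = Y ; f = tabulate id ; g = tabulate id ; f-emb = same-emb ; g-emb = id-emb
      ; joint = λ z → inj₂ (z , at z) ; comm = λ w → refl }
    amalgams (suc k) = new-amalgam k

    identified-system : IsRepSystem F W X Y i j (suc N) amalgams
    identified-system = (λ { zero → FY ; (suc k) → member k }) , represent , unique
      where
      represent : ∀ A → F (Z A) → ∃ λ k → AmalgIso W X Y i j A (amalgams k)
      represent A FZ with old? A
      ... | no ¬q = let k , I = new-representative A FZ (λ y q → ¬q (y , q)) in suc k , I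
      ... | yes (y , q) with identified A q
      ...   | refl , _ = zero , inverse Y (Z A) (g A) iso , inverse-iso Y (Z A) (g A) iso , on-f ,
              λ y → trans (inverse-left Y (Z A) (g A) iso y) (sym (at y))
        where
        onto : ∀ z → ∃ λ y → lookup (g A) y ≡ z
        onto z with joint A z
        ... | inj₁ (zero , p)  = zero , trans q p
        ... | inj₁ (suc w , p) = suc w , trans (sym (over-W A w)) p
        ... | inj₂ r           = r
        iso : IsIso Y (Z A) (g A)
        iso = g-emb A , onto
        on-f : ∀ x → lookup (inverse Y (Z A) (g A) iso) (lookup (f A) x) ≡ lookup (tabulate id) x
        on-f zero    = trans (cong (lookup (inverse Y (Z A) (g A) iso)) (sym q))
          (trans (inverse-left Y (Z A) (g A) iso zero) (sym (at zero)))
        on-f (suc w) = trans (cong (lookup (inverse Y (Z A) (g A) iso)) (over-W A w))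
          (trans (inverse-left Y (Z A) (g A) iso (suc w)) (sym (at (suc w))))
      not-same : ∀ A k → AmalgIso W X Y i j A (amalgams zero) → ¬ AmalgIso W X Y i j A (new-amalgam k)
      not-same A k (h , ((h-inj , _) , _) , h-f , h-g) I =
        new-not-old A k I zero (h-inj _ _ (trans (h-g zero) (sym (h-f zero))))
      unique : ∀ A k k′ → AmalgIso W X Y i j A (amalgams k) → AmalgIso W X Y i j A (amalgams k′) → k ≡ k′
      unique A zero    zero     _ _  = refl
      unique A zero    (suc k′) I I′ = ⊥-elim (not-same A k′ I I′)
      unique A (suc k) zero     I I′ = ⊥-elim (not-same A k I′ I)
      unique A (suc k) (suc k′) I I′ = cong suc (new-unique A k k′ I I′)

module Measure {n} {F : Str n → Set} (quartets : ∀ {Z} → F Z → QuartetSystem Z) (R : CommutativeRing 0ℓ 0ℓ)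
  (μ : (X Y : Str n) → Map X Y → CommutativeRing.Carrier R) (μ-measure : IsMeasure F R μ) where

  open CommutativeRing R renaming (refl to ≈-refl; sym to ≈-sym; trans to ≈-trans)

  μ-iso = proj₁ μ-measure
  μ-comp = proj₁ (proj₂ μ-measure)
  μ-sum = proj₂ (proj₂ μ-measure)

  module _ {W : Str n} {d e : Fin n} {r₁ r₀ : Profile (size W)} {N : ℕ}
    (FW : F W) (FX : F (Ext W e r₀)) (FY : F (Ext W d r₁)) (ps : Profiles F W d e r₁ r₀ N) where
    open Profiles ps
    open Extensions {F = F} quartets FW FX FY ps

    μ-separate : (d ≢ e ⊎ ∃ λ a → ∃ λ b → ∃ λ c → r₁ a b c ≢ r₀ a b c) →
      μ W (Ext W e r₀) (tabulate suc) ≈ ΣR F R {N} (λ k → μ Y (Ext Y e (profile k)) (tabulate suc))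
    μ-separate diff = μ-sum W _ Y _ _ FW FX FY (old-emb W e r₀) (old-emb W d r₁) N new-amalgam (separate-system diff)

    μ-identified : d ≡ e → (∀ a b c → r₁ a b c ≡ r₀ a b c) →
      μ W (Ext W e r₀) (tabulate suc) ≈ 1# + ΣR F R {N} (λ k → μ Y (Ext Y e (profile k)) (tabulate suc))
    μ-identified d≡e r≡ = ≈-trans
      (μ-sum W _ Y _ _ FW FX FY (old-emb W e r₀) (old-emb W d r₁) (suc N) (amalgams d≡e r≡) (identified-system d≡e r≡))
      (+-congʳ (μ-iso Y Y (tabulate id) FY FY (id-emb d≡e r≡ , λ y → y , lookup∘tabulate id y)))

  μ-square : ∀ {X X′ Z Z′} {f : Map X Z} {f′ : Map X′ Z′} (k : Map X′ X) (h : Map Z′ Z) →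
    F X → F X′ → F Z → F Z′ → IsEmb X Z f → IsEmb X′ Z′ f′ → IsIso X′ X k → IsIso Z′ Z h →
    comp X′ X Z f k ≡ comp X′ Z′ Z h f′ → μ X Z f ≈ μ X′ Z′ f′
  μ-square {X} {X′} {Z} {Z′} {f} {f′} k h FX FX′ FZ FZ′ f-emb f′-emb k-iso h-iso eq = begin
    μ X Z f                ≈⟨ *-identityʳ _ ⟨
    μ X Z f * 1#           ≈⟨ *-congˡ (μ-iso X′ X k FX′ FX k-iso) ⟨
    μ X Z f * μ X′ X k     ≈⟨ μ-comp X′ X Z k f FX′ FX FZ (proj₁ k-iso) f-emb ⟨
    μ X′ Z (comp X′ X Z f k) ≡⟨ cong (μ X′ Z) eq ⟩
    μ X′ Z (comp X′ Z′ Z h f′) ≈⟨ μ-comp X′ Z′ Z f′ h FX′ FZ′ FZ f′-emb (proj₁ h-iso) ⟩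
    μ Z′ Z h * μ X′ Z′ f′  ≈⟨ *-congʳ (μ-iso Z′ Z h FZ′ FZ h-iso) ⟩
    1# * μ X′ Z′ f′        ≈⟨ *-identityˡ _ ⟩
    μ X′ Z′ f′             ∎
    where open import Relation.Binary.Reasoning.Setoid setoid

-- Five points

Triple : ℕ → Set
Triple m = Fin m × Fin m × Fin m

matches : ∀ {m} → Triple m → Profile m
matches (x , y , z) a b c =
  does (a ≟ x) ∧ ((does (b ≟ y) ∧ does (c ≟ z)) ∨ (does (b ≟ z) ∧ does (c ≟ y)))

-- The profile of a new point ∗ with R(∗, x; y, z) exactly for the listed (x, y, z), up to swapping y and z.
attach : ∀ {m} → List (Triple m) → Profile m
attach []      a b c = false
attach (t ∷ l) a b c = matches t a b c ∨ attach l a b c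

Exhaustive : ∀ {m} → List (Triple m) → List (Triple m) → Set
Exhaustive present absent = ∀ a b c → a ≡ b ⊎ a ≡ c ⊎ b ≡ c ⊎
  attach present a b c ≡ true ⊎ attach present b a c ≡ true ⊎ attach present c a b ≡ true ⊎ attach absent a b c ≡ true

exhaustive? : ∀ {m} (present absent : List (Triple m)) → Dec (Exhaustive present absent)
exhaustive? present absent = all? λ a → all? λ b → all? λ c → a ≟ b ⊎-dec a ≟ c ⊎-dec b ≟ c ⊎-dec
  attach present a b c Bool.≟ true ⊎-dec attach present b a c Bool.≟ true ⊎-dec attach present c a b Bool.≟ true
  ⊎-dec attach absent a b c Bool.≟ true

∨-true : ∀ x {y} → x ∨ y ≡ true → x ≡ true ⊎ y ≡ true
∨-true true  _ = inj₁ refl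
∨-true false e = inj₂ e

∧-true : ∀ x {y} → x ∧ y ≡ true → x ≡ true × y ≡ true
∧-true true e = refl , e

matches-sound : ∀ {m} {x y z a b c : Fin m} → matches (x , y , z) a b c ≡ true →
  a ≡ x × (b ≡ y × c ≡ z ⊎ b ≡ z × c ≡ y)
matches-sound {x = x} {y} {z} {a} {b} {c} e = let ax , e′ = ∧-true (does (a ≟ x)) e in
  ≟-true {a = a} ax ,
  [ inj₁ ∘ both , inj₂ ∘ both ]′ (∨-true (does (b ≟ y) ∧ does (c ≟ z)) e′)
  where
  both : ∀ {p q} → does (b ≟ p) ∧ does (c ≟ q) ≡ true → b ≡ p × c ≡ q
  both {p} e = let bp , cq = ∧-true (does (b ≟ p)) e in ≟-true {a = b} bp , ≟-true {a = c} cq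

attach-elim : ∀ {m} {P : Fin m → Fin m → Fin m → Set} → (∀ {a b c} → P a b c → P a c b) →
  ∀ {l} → All (λ (x , y , z) → P x y z) l → ∀ {a b c} → attach l a b c ≡ true → P a b c
attach-elim P-swap {(x , y , z) ∷ l} (p ∷ ps) {a} {b} {c} e with ∨-true (matches (x , y , z) a b c) e
... | inj₂ e′ = attach-elim P-swap ps e′
... | inj₁ e′ with matches-sound {x = x} {y} {z} {a} {b} {c} e′
...   | refl , inj₁ (refl , refl) = p
...   | refl , inj₂ (refl , refl) = P-swap p

module Quartets {n} {Z : Str n} (QZ : QuartetSystem Z) where
  open QuartetSystem QZ public

  infix 4 _─_∣_─_
  _─_∣_─_ : Fin (size Z) → Fin (size Z) → Fin (size Z) → Fin (size Z) → Set
  a ─ b ∣ c ─ d = rel Z a b c d ≡ true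

  swapʳ : ∀ {a b c d} → a ─ b ∣ c ─ d → a ─ b ∣ d ─ c
  swapʳ = flip ∘ swap ∘ flip

  exclusive′ : ∀ {a b c d} → a ─ d ∣ b ─ c → ¬ a ─ b ∣ c ─ d
  exclusive′ r r′ = exclusive r (swapʳ r′)

  record Unresolved (a b c d : Fin (size Z)) : Set where
    constructor unresolved
    field
      not-ab : ¬ a ─ b ∣ c ─ d
      not-ac : ¬ a ─ c ∣ b ─ d
      not-ad : ¬ a ─ d ∣ b ─ c

  data Resolution (a b c d : Fin (size Z)) : Set where
    is-ab : a ─ b ∣ c ─ d → Resolution a b c d
    is-ac : a ─ c ∣ b ─ d → Resolution a b c d
    is-ad : a ─ d ∣ b ─ c → Resolution a b c d
    none  : Unresolved a b c d → Resolution a b c d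

  resolution : ∀ a b c d → Resolution a b c d
  resolution a b c d with rel Z a b c d Bool.≟ true | rel Z a c b d Bool.≟ true | rel Z a d b c Bool.≟ true
  ... | yes p | _     | _     = is-ab p
  ... | no _  | yes q | _     = is-ac q
  ... | no _  | no _  | yes r = is-ad r
  ... | no ¬p | no ¬q | no ¬r = none (unresolved ¬p ¬q ¬r)

  resolved-not-none : Resolved Z → ∀ {a b c d} → Distinct4 a b c d → ¬ Unresolved a b c d
  resolved-not-none res D (unresolved ¬p ¬q ¬r) = [ ¬p , [ ¬q , ¬r ]′ ]′ (res D)

  fits : ∀ {m} {present absent : List (Triple m)} → Exhaustive present absent → ∀ z (g : Fin m → Fin (size Z)) →
    All (λ (a , b , c) → z ─ g a ∣ g b ─ g c) present → All (λ (a , b , c) → ¬ z ─ g a ∣ g b ─ g c) absent →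
    ∀ a b c → rel Z z (g a) (g b) (g c) ≡ attach present a b c
  fits {present = present} ex z g yes-all no-all a b c with attach present a b c in eq
  ... | true  = attach-elim swapʳ yes-all eq
  ... | false = not-true (lemma (ex a b c))
    where
    lemma : a ≡ b ⊎ a ≡ c ⊎ b ≡ c ⊎ _ → ¬ z ─ g a ∣ g b ─ g c
    lemma (inj₁ refl) r               = let _ , _ , _ , p , _ = distinct r in p refl
    lemma (inj₂ (inj₁ refl)) r        = let _ , _ , _ , _ , p , _ = distinct r in p refl
    lemma (inj₂ (inj₂ (inj₁ refl))) r = let _ , _ , _ , _ , _ , p = distinct r in p refl
    lemma (inj₂ (inj₂ (inj₂ (inj₁ e)))) r with trans (sym eq) e
    ... | ()
    lemma (inj₂ (inj₂ (inj₂ (inj₂ (inj₁ e))))) r = exclusive (attach-elim swapʳ yes-all e) r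
    lemma (inj₂ (inj₂ (inj₂ (inj₂ (inj₂ (inj₁ e)))))) r = exclusive′ (attach-elim swapʳ yes-all e) r
    lemma (inj₂ (inj₂ (inj₂ (inj₂ (inj₂ (inj₂ e)))))) r = attach-elim (λ ¬p → ¬p ∘ swapʳ) no-all e r

  private variable z D A B C : Fin (size Z)

  zA-zD : B ≢ z → B ≢ A → D ≢ z → D ≢ B → z ≢ D → z ≢ B → z ─ A ∣ B ─ C → D ─ A ∣ B ─ C → z ─ D ∣ B ─ C
  zA-zD _ _ Dz DB zD zB zA DA with five Dz DB zA
  ... | inj₂ r = r
  ... | inj₁ r with five zD zB DA
  ...   | inj₁ r′ = ⊥-elim (exclusive (swapʳ (swap r′)) (swapʳ (swap r)))
  ...   | inj₂ r′ = swap r′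

  zD-transfer : C ≢ z → C ≢ A → z ─ A ∣ B ─ C → z ─ D ∣ A ─ B → z ─ D ∣ A ─ C
  zD-transfer Cz CA zA r with five Cz CA r
  ... | inj₁ r′ = r′
  ... | inj₂ r′ = ⊥-elim (exclusive r′ (swapʳ zA))

  zA-transfer : C ≢ z → C ≢ D → z ─ D ∣ B ─ C → z ─ A ∣ D ─ B → z ─ A ∣ D ─ C
  zA-transfer Cz CD zD r with five Cz CD r
  ... | inj₁ r′ = r′
  ... | inj₂ r′ = ⊥-elim (exclusive r′ (swapʳ zD))

  inner-transfer : C ≢ z → C ≢ D → z ─ D ∣ B ─ C → z ─ B ∣ D ─ A → z ─ C ∣ D ─ A
  inner-transfer Cz CD zD r with five CD Cz (flip r)
  ... | inj₁ r′ = flip r′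
  ... | inj₂ r′ = ⊥-elim (exclusive r′ (swapʳ (swap zD)))

  unresolved-transfer : B ≢ z → B ≢ A → B ≢ D → z ─ D ∣ B ─ C → z ─ A ∣ B ─ C → Unresolved z D A B → Unresolved z D A C
  unresolved-transfer Bz BA BD zD zA (unresolved p q r) = unresolved
    (p ∘ zD-transfer Bz BA (swapʳ zA)) (q ∘ zA-transfer Bz BD (swapʳ zD)) (r ∘ inner-transfer Bz BD (swapʳ zD))

  zB-DA : D ≢ B → D ≢ A → D ─ A ∣ B ─ C → z ─ B ∣ A ─ C → z ─ B ∣ D ─ A
  zB-DA DB DA da r with five DB DA (swap r)
  ... | inj₁ r′ = swapʳ (swap r′)
  ... | inj₂ r′ = ⊥-elim (exclusive da (swap r′))

  zB-DC : D ≢ B → D ≢ C → D ─ A ∣ B ─ C → z ─ B ∣ A ─ C → z ─ B ∣ D ─ C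
  zB-DC DB DC da r with five DB DC (swapʳ (swap r))
  ... | inj₁ r′ = swapʳ (swap r′)
  ... | inj₂ r′ = ⊥-elim (exclusive da (swap (swapʳ r′)))

  zC-DA : z ≢ A → z ≢ C → D ─ A ∣ B ─ C → ¬ z ─ A ∣ B ─ C → z ─ C ∣ D ─ A
  zC-DA zA zC da ¬r with five zA zC (swap (swapʳ da))
  ... | inj₁ r′ = swap (flip (swap r′))
  ... | inj₂ r′ = ⊥-elim (¬r (swap (swapʳ r′)))

  unresolved-zDBC : A ≢ z → A ≢ B → A ≢ C → z ─ B ∣ D ─ A → z ─ C ∣ D ─ A → Unresolved z A B C → Unresolved z D B C
  unresolved-zDBC Az AB AC zB zC (unresolved p q r) = unresolved
    (λ s → [ exclusive zB , p ]′ (five Az AB s))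
    (λ s → [ (λ s′ → q (swapʳ s′)) , exclusive (swapʳ zC) ]′ (five Az AC (swapʳ s)))
    (λ s → [ (λ s′ → r (swapʳ s′)) , exclusive (swapʳ zB) ]′ (five Az AB (swapʳ s)))

-- Small tree structures

ContainsTrees : ∀ {n} → ℕ → (Str n → Set) → Set
ContainsTrees k F = ∀ {X v} {G : Graph v} → TreeRealisation X G → (∀ u → deg G u ≤ k) → F X

AllResolved : ∀ {n} → (Str n → Set) → Set
AllResolved F = ∀ {X} → F X → Resolved X

record TreeClass {n} (F : Str n → Set) : Set where
  field
    quartets : ∀ {Z} → F Z → QuartetSystem Z
    cubic    : ContainsTrees 3 F
    centres  : ContainsTrees 4 F ⊎ AllResolved F

-- In Tripod a b c and Quartet d a b c the points come in the order of the colours;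
-- the latter is the quartet d a | b c, and its profiles below are those of a fifth point.

Pair : ∀ {n} → Fin n → Fin n → Str n
Pair a b = mkStr 2 (λ _ _ _ _ → false) (lookup (a ∷ b ∷ []))

Tripod : ∀ {n} → Fin n → Fin n → Fin n → Str n
Tripod a b c = Ext (Pair b c) a (attach [])

centre₃ edge₀ edge₁ edge₂ : List (Triple 3)
centre₃ = []
edge₀ = (# 0 , # 1 , # 2) ∷ []
edge₁ = (# 1 , # 0 , # 2) ∷ []
edge₂ = (# 2 , # 0 , # 1) ∷ []

Quartet : ∀ {n} → Fin n → Fin n → Fin n → Fin n → Str n
Quartet d a b c = Ext (Tripod a b c) d (attach edge₀)

at-d at-a at-b inner centre-da centre-bc : List (Triple 4)
at-d      = (# 0 , # 1 , # 2) ∷ (# 0 , # 1 , # 3) ∷ (# 0 , # 2 , # 3) ∷ (# 1 , # 2 , # 3) ∷ []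
at-a      = (# 1 , # 0 , # 2) ∷ (# 1 , # 0 , # 3) ∷ (# 0 , # 2 , # 3) ∷ (# 1 , # 2 , # 3) ∷ []
at-b      = (# 2 , # 0 , # 1) ∷ (# 3 , # 0 , # 1) ∷ (# 2 , # 0 , # 3) ∷ (# 2 , # 1 , # 3) ∷ []
inner     = (# 2 , # 0 , # 1) ∷ (# 3 , # 0 , # 1) ∷ (# 0 , # 2 , # 3) ∷ (# 1 , # 2 , # 3) ∷ []
centre-da = (# 0 , # 2 , # 3) ∷ (# 1 , # 2 , # 3) ∷ []
centre-bc = (# 2 , # 0 , # 1) ∷ (# 3 , # 0 , # 1) ∷ []

face : Fin 4 → Fin 4 → Fin 4 → List (Triple 4)
face x y z = (x , y , z) ∷ (y , x , z) ∷ (z , x , y) ∷ []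

restricts? : ∀ {m N} (ls : Vec (List (Triple (suc m))) N) (r : Profile m) →
  Dec (∀ k a b c → attach (lookup ls k) (suc a) (suc b) (suc c) ≡ r a b c)
restricts? ls r = all? λ k → all? λ a → all? λ b → all? λ c →
  attach (lookup ls k) (suc a) (suc b) (suc c) Bool.≟ r a b c

different? : ∀ {m N} (ls : Vec (List (Triple m)) N) →
  Dec (∀ k k′ → (∀ a b c → attach (lookup ls k) a b c ≡ attach (lookup ls k′) a b c) → k ≡ k′)
different? ls = all? λ k → all? λ k′ →
  (all? λ a → all? λ b → all? λ c → attach (lookup ls k) a b c Bool.≟ attach (lookup ls k′) a b c) →-dec k ≟ k′

relational-iso? : ∀ {n} (X Z : Str n) (h : Map X Z) → Dec (
  (∀ a b → lookup h a ≡ lookup h b → a ≡ b)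
  × (∀ a b c d → rel Z (lookup h a) (lookup h b) (lookup h c) (lookup h d) ≡ rel X a b c d)
  × (∀ y → ∃ λ x → lookup h x ≡ y))
relational-iso? X Z h =
  (all? λ a → all? λ b → lookup h a ≟ lookup h b →-dec a ≟ b)
  ×-dec (all? λ a → all? λ b → all? λ c → all? λ d →
          rel Z (lookup h a) (lookup h b) (lookup h c) (lookup h d) Bool.≟ rel X a b c d)
  ×-dec (all? λ y → any? λ x → lookup h x ≟ y)

concrete-iso : ∀ {n} (X Z : Str n) (h : Map X Z) → True (relational-iso? X Z h) →
  Vec.map (col Z) h ≡ tabulate (col X) → IsIso X Z h
concrete-iso X Z h t cols = let inj , rels , onto = toWitness t in
  (inj , rels , λ a → trans (sym (lookup-map a (col Z) h)) (trans (cong (λ v → lookup v a) cols) (lookup∘tabulate (col X) a))) , onto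

comp-emb : ∀ {n} {X Y Z : Str n} {f : Map X Y} {g : Map Y Z} → IsEmb X Y f → IsEmb Y Z g → IsEmb X Z (comp X Y Z g f)
comp-emb {X = X} {Y} {Z} {f} {g} (f-inj , f-rel , f-col) (g-inj , g-rel , g-col) =
  (λ a b eq → f-inj a b (g-inj _ _ (trans (sym (at a)) (trans eq (at b)))))
  , (λ a b c d → trans (rel-cong Z (at a) (at b) (at c) (at d)) (trans (g-rel _ _ _ _) (f-rel a b c d)))
  , (λ a → trans (cong (col Z) (at a)) (trans (g-col _) (f-col a)))
  where
  at : ∀ a → lookup (comp X Y Z g f) a ≡ lookup g (lookup f a)
  at a = lookup-map a (lookup g) f

module Members {n} {F : Str n → Set} (class : TreeClass F) where
  open TreeClass class

  member : ∀ {m v} (t : Growth v) (ℓ : Vec (Fin v) m) {r col} → True (realises? t (lookup ℓ) 3 r) → F (mkStr m r col)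
  member t ℓ w = let real = toWitness w in
    cubic (realisation t (lookup ℓ) _ real) (proj₁ (proj₂ (proj₂ (proj₂ real))))

  pair∈ : ∀ a b → F (Pair a b)
  pair∈ a b = member (sprout (# 0) seed) (# 0 ∷ # 1 ∷ []) _

  tripod∈ : ∀ a b c → F (Tripod a b c)
  tripod∈ a b c = member (sprout (# 2) (sprout (# 1) (sprout (# 0) seed))) (# 0 ∷ # 1 ∷ # 2 ∷ []) _

  private
    H : Growth 6
    H = sprout (# 3) (sprout (# 2) (sprout (# 2) (sprout (# 1) (sprout (# 0) seed))))
    caterpillar : Growth 8
    caterpillar = sprout (# 4) (sprout (# 3) (sprout (# 3) (sprout (# 3) (sprout (# 2) (sprout (# 0) (sprout (# 0) seed))))))

  edge₀∈ : ∀ a b c e → F (Ext (Tripod a b c) e (attach edge₀))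
  edge₀∈ a b c e = member H (# 0 ∷ # 1 ∷ # 2 ∷ # 3 ∷ []) _

  edge₁∈ : ∀ a b c e → F (Ext (Tripod a b c) e (attach edge₁))
  edge₁∈ a b c e = member H (# 0 ∷ # 2 ∷ # 1 ∷ # 3 ∷ []) _

  edge₂∈ : ∀ a b c e → F (Ext (Tripod a b c) e (attach edge₂))
  edge₂∈ a b c e = member H (# 0 ∷ # 2 ∷ # 3 ∷ # 1 ∷ []) _

  at-d∈ : ∀ d a b c e → F (Ext (Quartet d a b c) e (attach at-d))
  at-d∈ d a b c e = member caterpillar (# 0 ∷ # 1 ∷ # 2 ∷ # 3 ∷ # 4 ∷ []) _

  at-a∈ : ∀ d a b c e → F (Ext (Quartet d a b c) e (attach at-a))
  at-a∈ d a b c e = member caterpillar (# 0 ∷ # 2 ∷ # 1 ∷ # 3 ∷ # 4 ∷ []) _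

  at-b∈ : ∀ d a b c e → F (Ext (Quartet d a b c) e (attach at-b))
  at-b∈ d a b c e = member caterpillar (# 0 ∷ # 3 ∷ # 4 ∷ # 1 ∷ # 2 ∷ []) _

  inner∈ : ∀ d a b c e → F (Ext (Quartet d a b c) e (attach inner))
  inner∈ d a b c e = member caterpillar (# 2 ∷ # 0 ∷ # 1 ∷ # 3 ∷ # 4 ∷ []) _

  module Stars (star : ContainsTrees 4 F) where

    star-member : ∀ {m v} (t : Growth v) (ℓ : Vec (Fin v) m) {r col} → True (realises? t (lookup ℓ) 4 r) → F (mkStr m r col)
    star-member t ℓ w = let real = toWitness w in
      star (realisation t (lookup ℓ) _ real) (proj₁ (proj₂ (proj₂ (proj₂ real))))

    private
      fork : Growth 7
      fork = sprout (# 4) (sprout (# 3) (sprout (# 2) (sprout (# 2) (sprout (# 1) (sprout (# 0) seed)))))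

    centre₃∈ : ∀ a b c e → F (Ext (Tripod a b c) e (attach centre₃))
    centre₃∈ a b c e = star-member (sprout (# 3) (sprout (# 2) (sprout (# 1) (sprout (# 0) seed)))) (# 0 ∷ # 1 ∷ # 2 ∷ # 3 ∷ []) _

    centre-da∈ : ∀ d a b c e → F (Ext (Quartet d a b c) e (attach centre-da))
    centre-da∈ d a b c e = star-member fork (# 0 ∷ # 1 ∷ # 2 ∷ # 3 ∷ # 4 ∷ []) _

    centre-bc∈ : ∀ d a b c e → F (Ext (Quartet d a b c) e (attach centre-bc))
    centre-bc∈ d a b c e = star-member fork (# 0 ∷ # 3 ∷ # 4 ∷ # 1 ∷ # 2 ∷ []) _

  module Point {Y Z : Str n} (FZ : F Z) (g : Map Y Z) (g-emb : IsEmb Y Z g)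
    (z : Fin (size Z)) (z∉g : ∀ y → lookup g y ≢ z) where
    open Quartets (quartets FZ) public

    P : Fin (size Y) → Fin (size Z)
    P = lookup g

    P≢ : ∀ {i j} → i ≢ j → P i ≢ P j
    P≢ ne = ne ∘ proj₁ g-emb _ _

    z≢ : ∀ {i} → z ≢ P i
    z≢ eq = z∉g _ (sym eq)

    distinct-z : ∀ {i j k} → i ≢ j → i ≢ k → j ≢ k → Distinct4 z (P i) (P j) (P k)
    distinct-z ij ik jk = z≢ , z≢ , z≢ , P≢ ij , P≢ ik , P≢ jk

    inherited : ∀ {i j k l} → rel Y i j k l ≡ true → P i ─ P j ∣ P k ─ P l
    inherited = trans (proj₁ (proj₂ g-emb) _ _ _ _)

    Fits : List (Triple (size Y)) → Set
    Fits l = ∀ a b c → rel Z z (P a) (P b) (P c) ≡ attach l a b c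

  module _ (a b d e : Fin n) where
    private
      edges : Vec (List (Triple 3)) 3
      edges = edge₀ ∷ edge₁ ∷ edge₂ ∷ []

    module _ {Z : Str n} (FZ : F Z) (g : Map (Tripod d a b) Z) (g-emb : IsEmb (Tripod d a b) Z g)
      (z : Fin (size Z)) (z∉g : ∀ y → lookup g y ≢ z) where
      open Point FZ g g-emb z z∉g

      tripod-cases : (∃ λ k → Fits (lookup edges k)) ⊎ Fits centre₃ × Unresolved z (P (# 0)) (P (# 1)) (P (# 2))
      tripod-cases with resolution z (P (# 0)) (P (# 1)) (P (# 2))
      ... | is-ab r = inj₁ (# 0 , fits (toWitness {a? = exhaustive? edge₀ []} _) z P (r ∷ []) [])
      ... | is-ac r = inj₁ (# 1 , fits (toWitness {a? = exhaustive? edge₁ []} _) z P (r ∷ []) [])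
      ... | is-ad r = inj₁ (# 2 , fits (toWitness {a? = exhaustive? edge₂ []} _) z P (r ∷ []) [])
      ... | none u@(unresolved p q r) = inj₂
              (fits (toWitness {a? = exhaustive? centre₃ ((# 0 , # 1 , # 2) ∷ (# 1 , # 0 , # 2) ∷ (# 2 , # 0 , # 1) ∷ [])} _)
                 z P [] (p ∷ q ∷ r ∷ []) , u)

    resolved-tripod-profiles : AllResolved F → Profiles F (Pair a b) d e (attach []) (attach []) 3
    resolved-tripod-profiles res = record
      { profile = attach ∘ lookup edges
      ; member = λ { zero → edge₀∈ d a b e ; (suc zero) → edge₁∈ d a b e ; (suc (suc zero)) → edge₂∈ d a b e }
      ; restricts = toWitness {a? = restricts? edges _} _
      ; different = toWitness {a? = different? edges} _
      ; complete = λ FZ g g-emb z z∉g _ → let open Point FZ g g-emb z z∉g in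
          [ id , (λ (_ , u) → ⊥-elim (resolved-not-none (res FZ) (distinct-z (λ ()) (λ ()) (λ ())) u)) ]′ (tripod-cases FZ g g-emb z z∉g)
      }

    star-tripod-profiles : ContainsTrees 4 F →
      Profiles F (Pair a b) d e (attach []) (attach []) 4
    star-tripod-profiles star = record
      { profile = attach ∘ lookup (centre₃ ∷ edges)
      ; member = λ { zero → Stars.centre₃∈ star d a b e ; (suc zero) → edge₀∈ d a b e ; (suc (suc zero)) → edge₁∈ d a b e
                   ; (suc (suc (suc zero))) → edge₂∈ d a b e }
      ; restricts = toWitness {a? = restricts? (centre₃ ∷ edges) _} _
      ; different = toWitness {a? = different? (centre₃ ∷ edges)} _
      ; complete = λ FZ g g-emb z z∉g _ →
          [ (λ (k , fit) → suc k , fit) , (λ (fit , _) → zero , fit) ]′ (tripod-cases FZ g g-emb z z∉g)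
      }

  module _ (d a b c e : Fin n) where
    private
      sites : Vec (List (Triple 4)) 3
      sites = at-d ∷ at-a ∷ inner ∷ []

    module _ {Z : Str n} (FZ : F Z) (g : Map (Quartet d a b c) Z) (g-emb : IsEmb (Quartet d a b c) Z g)
      (z : Fin (size Z)) (z∉g : ∀ y → lookup g y ≢ z) where
      open Point FZ g g-emb z z∉g
      private
        D = P (# 0) ; A = P (# 1) ; B = P (# 2) ; C = P (# 3)

        DA : D ─ A ∣ B ─ C
        DA = inherited {# 0} {# 1} {# 2} {# 3} refl

        ≢01 : D ≢ A
        ≢01 = P≢ λ ()
        ≢02 : D ≢ B
        ≢02 = P≢ λ ()
        ≢03 : D ≢ C
        ≢03 = P≢ λ ()
        ≢12 : A ≢ B
        ≢12 = P≢ λ ()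
        ≢13 : A ≢ C
        ≢13 = P≢ λ ()

        ≢z : ∀ {i} → P i ≢ z
        ≢z = z∉g _

      quartet-cases : z ─ A ∣ B ─ C → (∃ λ k → Fits (lookup sites k)) ⊎ Fits centre-da × Unresolved z D A B
      quartet-cases zA with zA-zD ≢z (≢12 ∘ sym) ≢z ≢02 z≢ z≢ zA DA
      ... | zD with resolution z D A B
      ...   | is-ab r = inj₁ (# 0 , fits (toWitness {a? = exhaustive? at-d []} _) z P
                (r ∷ zD-transfer ≢z (≢13 ∘ sym) zA r ∷ zD ∷ zA ∷ []) [])
      ...   | is-ac r = inj₁ (# 1 , fits (toWitness {a? = exhaustive? at-a []} _) z P
                (r ∷ zA-transfer ≢z (≢03 ∘ sym) zD r ∷ zD ∷ zA ∷ []) [])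
      ...   | is-ad r = inj₁ (# 2 , fits (toWitness {a? = exhaustive? inner []} _) z P
                (r ∷ inner-transfer ≢z (≢03 ∘ sym) zD r ∷ zD ∷ zA ∷ []) [])
      ...   | none u@(unresolved p q r) with unresolved-transfer ≢z (≢12 ∘ sym) (≢02 ∘ sym) zD zA u
      ...     | unresolved p′ q′ r′ = inj₂ (fits (toWitness {a? = exhaustive? centre-da (face (# 0) (# 1) (# 2) ++ face (# 0) (# 1) (# 3))} _) z P
                (zD ∷ zA ∷ []) (p ∷ q ∷ r ∷ p′ ∷ q′ ∷ r′ ∷ []) , u)

      at-b-fits : z ─ B ∣ A ─ C → Fits at-b
      at-b-fits zB = fits (toWitness {a? = exhaustive? at-b []} _) z P
        (zB-DA ≢02 ≢01 DA zB ∷ zC-DA z≢ z≢ DA (exclusive zB) ∷ zB-DC ≢02 ≢03 DA zB ∷ zB ∷ []) []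

      centre-bc-fits : Unresolved z A B C → Fits centre-bc
      centre-bc-fits u@(unresolved p q r) = fits
        (toWitness {a? = exhaustive? centre-bc (face (# 0) (# 2) (# 3) ++ face (# 1) (# 2) (# 3))} _) z P
        (zB ∷ zC ∷ []) (p′ ∷ q′ ∷ r′ ∷ p ∷ q ∷ r ∷ [])
        where
        zC : z ─ C ∣ D ─ A
        zC = zC-DA z≢ z≢ DA p
        zB : z ─ B ∣ D ─ A
        zB = zC-DA z≢ z≢ (swapʳ DA) (p ∘ swapʳ)
        open Unresolved (unresolved-zDBC ≢z ≢12 ≢13 zB zC u) renaming (not-ab to p′; not-ac to q′; not-ad to r′)

    resolved-quartet-profiles : AllResolved F → Profiles F (Tripod a b c) d e (attach edge₀) (attach edge₀) 3
    resolved-quartet-profiles res = record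
      { profile = attach ∘ lookup sites
      ; member = λ { zero → at-d∈ d a b c e ; (suc zero) → at-a∈ d a b c e ; (suc (suc zero)) → inner∈ d a b c e }
      ; restricts = toWitness {a? = restricts? sites _} _
      ; different = toWitness {a? = different? sites} _
      ; complete = λ FZ g g-emb z z∉g z-rel → let open Point FZ g g-emb z z∉g in
          [ id , (λ (_ , u) → ⊥-elim (resolved-not-none (res FZ) (distinct-z (λ ()) (λ ()) (λ ())) u)) ]′
            (quartet-cases FZ g g-emb z z∉g (z-rel (# 0) (# 1) (# 2)))
      }

    star-quartet-profiles : ContainsTrees 4 F →
      Profiles F (Tripod a b c) d e (attach edge₀) (attach edge₀) 4
    star-quartet-profiles star = record
      { profile = attach ∘ lookup (centre-da ∷ sites)
      ; member = λ { zero → Stars.centre-da∈ star d a b c e ; (suc zero) → at-d∈ d a b c e ; (suc (suc zero)) → at-a∈ d a b c e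
                   ; (suc (suc (suc zero))) → inner∈ d a b c e }
      ; restricts = toWitness {a? = restricts? (centre-da ∷ sites) _} _
      ; different = toWitness {a? = different? (centre-da ∷ sites)} _
      ; complete = λ FZ g g-emb z z∉g z-rel →
          [ (λ (k , fit) → suc k , fit) , (λ (fit , _) → zero , fit) ]′ (quartet-cases FZ g g-emb z z∉g (z-rel (# 0) (# 1) (# 2)))
      }

    at-b-profiles : Profiles F (Tripod a b c) d e (attach edge₀) (attach edge₁) 1
    at-b-profiles = record
      { profile = attach ∘ lookup (at-b ∷ [])
      ; member = λ { zero → at-b∈ d a b c e }
      ; restricts = toWitness {a? = restricts? (at-b ∷ []) _} _
      ; different = toWitness {a? = different? (at-b ∷ [])} _
      ; complete = λ FZ g g-emb z z∉g z-rel → zero , at-b-fits FZ g g-emb z z∉g (z-rel (# 1) (# 0) (# 2))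
      }

    centre-bc-profiles : ContainsTrees 4 F →
      Profiles F (Tripod a b c) d e (attach edge₀) (attach centre₃) 1
    centre-bc-profiles star = record
      { profile = attach ∘ lookup (centre-bc ∷ [])
      ; member = λ { zero → Stars.centre-bc∈ star d a b c e }
      ; restricts = toWitness {a? = restricts? (centre-bc ∷ []) _} _
      ; different = toWitness {a? = different? (centre-bc ∷ [])} _
      ; complete = λ FZ g g-emb z z∉g z-rel → zero , centre-bc-fits FZ g g-emb z z∉g
          (let open Point FZ g g-emb z z∉g in unresolved
            (absent (z-rel (# 0) (# 1) (# 2))) (absent (z-rel (# 1) (# 0) (# 2))) (absent (z-rel (# 2) (# 0) (# 1))))
      }
      where
      absent : ∀ {x} → x ≡ false → x ≢ true
      absent refl ()

-- The relations between the values of a measure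

-- u e a b, x a e, y e and v d a e are the values of adding a point of colour e to a pair ab, on the edge at
-- the leaf a of a tripod, at the centre of a tripod (0 if degree four is not allowed), and on the inner edge
-- of a quartet with d next to a; x and y do not depend on the colours of the remaining leaves.

record Relations (R : CommutativeRing 0ℓ 0ℓ) (n : ℕ) : Set where
  open CommutativeRing R using (Carrier; _≈_; _+_; _*_; 1#)
  field
    u     : Fin n → Fin n → Fin n → Carrier
    x     : Fin n → Fin n → Carrier
    y     : Fin n → Carrier
    v     : Fin n → Fin n → Fin n → Carrier
    u-≢   : ∀ a b {d e} → d ≢ e → u e a b ≈ y e + (x d e + (x a e + x b e))
    u-≡   : ∀ a b e → u e a b ≈ 1# + (y e + (x e e + (x a e + x b e)))
    x-≢   : ∀ a {d e} → d ≢ e → x a e ≈ y e + (x d e + (x a e + v d a e))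
    x-≡   : ∀ a e → x a e ≈ 1# + (y e + (x e e + (x a e + v e a e)))
    swap-u : ∀ a b d e → x d e * u d a b ≈ x e d * u e a b
    swap-x : ∀ a d e → x a e * x a d ≈ v e a d * x a e

module Collapse {R : CommutativeRing 0ℓ 0ℓ} {n} (rels : Relations R n) {c c′ : Fin n} (c≢c′ : c ≢ c′) where
  open CommutativeRing R renaming (refl to ≈-refl; sym to ≈-sym; trans to ≈-trans)
  open Relations rels
  open GroupProperties +-group using () renaming (∙-cancelˡ to +-cancelˡ; ∙-cancelʳ to +-cancelʳ)
  open SemiringSolver commutativeSemiring using (solve; _:+_; _:*_; _:=_; con)
  open SetoidReasoning setoid

  x-shift : ∀ {d e} → d ≢ e → x d e ≈ 1# + x e e
  x-shift {d} {e} d≢e = +-cancelʳ (y e + (x e e + x e e)) _ _ (begin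
    x d e + (y e + (x e e + x e e))           ≈⟨ solve 3 (λ p q r → p :+ (q :+ (r :+ r)) := q :+ (p :+ (r :+ r))) ≈-refl _ _ _ ⟩
    y e + (x d e + (x e e + x e e))           ≈⟨ u-≢ e e d≢e ⟨
    u e e e                                   ≈⟨ u-≡ e e e ⟩
    1# + (y e + (x e e + (x e e + x e e)))    ≈⟨ solve 3 (λ p q r → p :+ (q :+ (r :+ (r :+ r))) := (p :+ r) :+ (q :+ (r :+ r))) ≈-refl _ _ _ ⟩
    (1# + x e e) + (y e + (x e e + x e e))    ∎)

  v-value : ∀ f a {d e} → d ≢ e → v f a e + (y e + x d e) ≈ 0#
  v-value f a {d} {e} d≢e with f ≟ e
  ... | no f≢e = +-cancelˡ (x a e) _ _ (begin
    x a e + (v f a e + (y e + x d e))   ≈⟨ +-congˡ (+-congˡ (+-congˡ (≈-trans (x-shift d≢e) (≈-sym (x-shift f≢e))))) ⟩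
    x a e + (v f a e + (y e + x f e))   ≈⟨ solve 4 (λ p q r s → p :+ (q :+ (r :+ s)) := r :+ (s :+ (p :+ q))) ≈-refl _ _ _ _ ⟩
    y e + (x f e + (x a e + v f a e))   ≈⟨ x-≢ a f≢e ⟨
    x a e                               ≈⟨ +-identityʳ _ ⟨
    x a e + 0#                          ∎)
  ... | yes refl = +-cancelˡ (x a e) _ _ (begin
    x a e + (v e a e + (y e + x d e))         ≈⟨ +-congˡ (+-congˡ (+-congˡ (x-shift d≢e))) ⟩
    x a e + (v e a e + (y e + (1# + x e e)))  ≈⟨ solve 5 (λ p q r o s → p :+ (q :+ (r :+ (o :+ s))) := o :+ (r :+ (s :+ (p :+ q)))) ≈-refl _ _ _ _ _ ⟩
    1# + (y e + (x e e + (x a e + v e a e)))  ≈⟨ x-≡ a e ⟨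
    x a e                                     ≈⟨ +-identityʳ _ ⟨
    x a e + 0#                                ∎)

  x-product : ∀ a e {d d′} → d′ ≢ d → x a e * (x a d + (y d + x d′ d)) ≈ 0#
  x-product a e {d} {d′} d′≢d = begin
    x a e * (x a d + (y d + x d′ d))                ≈⟨ distribˡ _ _ _ ⟩
    x a e * x a d + x a e * (y d + x d′ d)          ≈⟨ +-congʳ (swap-x a d e) ⟩
    v e a d * x a e + x a e * (y d + x d′ d)        ≈⟨ solve 3 (λ p q r → p :* q :+ q :* r := q :* (p :+ r)) ≈-refl _ _ _ ⟩
    x a e * (v e a d + (y d + x d′ d))              ≈⟨ *-congˡ (v-value e a d′≢d) ⟩
    x a e * 0#                                      ≈⟨ zeroʳ _ ⟩
    0#                                              ∎

  u-shift : ∀ {d e} → d ≢ e → u e d d ≈ 1# + u e d e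
  u-shift {d} {e} d≢e = begin
    u e d d                                     ≈⟨ u-≢ d d d≢e ⟩
    y e + (x d e + (x d e + x d e))             ≈⟨ +-congˡ (+-congˡ (+-congˡ (x-shift d≢e))) ⟩
    y e + (x d e + (x d e + (1# + x e e)))      ≈⟨ solve 4 (λ p q r s → p :+ (q :+ (q :+ (r :+ s))) := r :+ (p :+ (q :+ (q :+ s)))) ≈-refl _ _ _ _ ⟩
    1# + (y e + (x d e + (x d e + x e e)))      ≈⟨ +-congˡ (u-≢ d e d≢e) ⟨
    1# + u e d e                                ∎

  u-shift′ : ∀ {d e} → d ≢ e → u e e d ≈ 1# + u e e e
  u-shift′ {d} {e} d≢e = begin
    u e e d                                     ≈⟨ u-≢ e d d≢e ⟩
    y e + (x d e + (x e e + x d e))             ≈⟨ +-congˡ (+-congˡ (+-congˡ (x-shift d≢e))) ⟩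
    y e + (x d e + (x e e + (1# + x e e)))      ≈⟨ solve 4 (λ p q r s → p :+ (q :+ (s :+ (r :+ s))) := r :+ (p :+ (q :+ (s :+ s)))) ≈-refl _ _ _ _ ⟩
    1# + (y e + (x d e + (x e e + x e e)))      ≈⟨ +-congˡ (u-≢ e e d≢e) ⟨
    1# + u e e e                                ∎

  private
    c′≢c : c′ ≢ c
    c′≢c = c≢c′ ∘ sym

    p q K P U V s t : Carrier
    p = x c c
    q = x c′ c′
    s = x c′ c
    t = x c c′
    K = y c + x c′ c
    P = p + K
    U = u c c′ c
    V = u c′ c′ c′

    s+K : s + K ≈ 1# + P
    s+K = ≈-trans (+-congʳ (x-shift c′≢c)) (+-assoc _ _ _)

    s+P≈0 : s + P ≈ 0#
    s+P≈0 = begin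
      s + P                   ≈⟨ +-congʳ (x-shift c′≢c) ⟩
      (1# + p) + P            ≈⟨ +-identityʳ _ ⟨
      ((1# + p) + P) + 0#     ≈⟨ +-congˡ (x-product c c c′≢c) ⟨
      ((1# + p) + P) + p * P  ≈⟨ solve 2 (λ p P → ((con 1 :+ p) :+ P) :+ p :* P := (con 1 :+ p) :* (con 1 :+ P)) ≈-refl p P ⟩
      (1# + p) * (1# + P)     ≈⟨ *-cong (x-shift c′≢c) s+K ⟨
      s * (s + K)             ≈⟨ x-product c′ c c′≢c ⟩
      0#                      ∎

    q≈P : q ≈ P
    q≈P = +-cancelʳ (q * P) _ _ (begin
      q + q * P         ≈⟨ solve 2 (λ q P → q :+ q :* P := q :* (con 1 :+ P)) ≈-refl q P ⟩
      q * (1# + P)      ≈⟨ *-congˡ s+K ⟨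
      q * (s + K)       ≈⟨ x-product c′ c′ c′≢c ⟩
      0#                ≈⟨ x-product c c′ c′≢c ⟨
      t * P             ≈⟨ *-congʳ (x-shift c≢c′) ⟩
      (1# + q) * P      ≈⟨ solve 2 (λ q P → (con 1 :+ q) :* P := P :+ q :* P) ≈-refl q P ⟩
      P + q * P         ∎)

    s+t≈0 : s + t ≈ 0#
    s+t≈0 = +-cancelʳ (s * V) _ _ (begin
      (s + t) + s * V      ≈⟨ solve 3 (λ s t V → (s :+ t) :+ s :* V := t :+ s :* (con 1 :+ V)) ≈-refl s t V ⟩
      t + s * (1# + V)     ≈⟨ +-congˡ (*-congˡ (u-shift′ c≢c′)) ⟨
      t + s * u c′ c′ c    ≈⟨ +-congˡ (swap-u c′ c c c′) ⟨
      t + t * U            ≈⟨ solve 2 (λ t U → t :+ t :* U := t :* (con 1 :+ U)) ≈-refl t U ⟩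
      t * (1# + U)         ≈⟨ *-congˡ (u-shift c′≢c) ⟨
      t * u c c′ c′        ≈⟨ swap-u c′ c′ c c′ ⟩
      s * V                ≈⟨ +-identityˡ _ ⟨
      0# + s * V           ∎)

  1≈0 : 1# ≈ 0#
  1≈0 = begin
    1#              ≈⟨ +-identityʳ _ ⟨
    1# + 0#         ≈⟨ +-congˡ s+P≈0 ⟨
    1# + (s + P)    ≈⟨ +-congˡ (+-congˡ q≈P) ⟨
    1# + (s + q)    ≈⟨ solve 2 (λ s q → con 1 :+ (s :+ q) := s :+ (con 1 :+ q)) ≈-refl s q ⟩
    s + (1# + q)    ≈⟨ +-congˡ (x-shift c≢c′) ⟨
    s + t           ≈⟨ s+t≈0 ⟩
    0#              ∎

module Values {n} {F : Str n → Set} (class : TreeClass F) (R : CommutativeRing 0ℓ 0ℓ)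
  (μ : (X Y : Str n) → Map X Y → CommutativeRing.Carrier R) (μ-measure : IsMeasure F R μ) where

  open CommutativeRing R hiding (zero) renaming (refl to ≈-refl; sym to ≈-sym; trans to ≈-trans)
  open TreeClass class
  open Members class
  open Measure {F = F} quartets R μ μ-measure
  open SetoidReasoning setoid

  υ : Fin n → Fin n → Fin n → Carrier
  υ e a b = μ (Pair a b) (Tripod e a b) (tabulate suc)

  τ : List (Triple 3) → (a b c e : Fin n) → Carrier
  τ l a b c e = μ (Tripod a b c) (Ext (Tripod a b c) e (attach l)) (tabulate suc)

  κ : List (Triple 4) → (d a b c e : Fin n) → Carrier
  κ l d a b c e = μ (Quartet d a b c) (Ext (Quartet d a b c) e (attach l)) (tabulate suc)

  quartet∈ : ∀ d a b c → F (Quartet d a b c)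
  quartet∈ d a b c = edge₀∈ a b c d

  μ-relabel : ∀ X X′ r r′ e (k : Map X′ X) → F X → F X′ → F (Ext X e r) → F (Ext X′ e r′) →
    True (relational-iso? X′ X k) → Vec.map (col X) k ≡ tabulate (col X′) →
    True (relational-iso? (Ext X′ e r′) (Ext X e r) (zero ∷ Vec.map suc k)) →
    Vec.map (col (Ext X e r)) (zero ∷ Vec.map suc k) ≡ tabulate (col (Ext X′ e r′)) →
    comp X′ X (Ext X e r) (tabulate suc) k ≡ comp X′ (Ext X′ e r′) (Ext X e r) (zero ∷ Vec.map suc k) (tabulate suc) →
    μ X (Ext X e r) (tabulate suc) ≈ μ X′ (Ext X′ e r′) (tabulate suc)
  μ-relabel X X′ r r′ e k FX FX′ FZ FZ′ k-rel k-col h-rel h-col eq =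
    μ-square {X} {X′} {Ext X e r} {Ext X′ e r′} {tabulate suc} {tabulate suc} k (zero ∷ Vec.map suc k)
      FX FX′ FZ FZ′ (old-emb X e r) (old-emb X′ e r′)
      (concrete-iso X′ X k k-rel k-col) (concrete-iso (Ext X′ e r′) (Ext X e r) (zero ∷ Vec.map suc k) h-rel h-col) eq

  module Exchange (W : Str n) (d e : Fin n) (r₁ r₀ : Profile (size W)) (r r′ : Profile (suc (size W))) where
    private
      X X′ V V′ : Str n
      X  = Ext W d r₁
      X′ = Ext W e r₀
      V  = Ext X e r
      V′ = Ext X′ d r′

      via-X : Map W V
      via-X = comp W X V (tabulate suc) (tabulate suc)

      via-X′ : Map W V′
      via-X′ = comp W X′ V′ (tabulate suc) (tabulate suc)

      h : Map V′ V
      h = suc zero ∷ zero ∷ tabulate λ a → suc (suc a)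

      one : Map W W
      one = tabulate id

      one-iso : IsIso W W one
      one-iso = tabulate-emb W W id (λ _ _ → id) (λ _ _ _ _ → refl) (λ _ → refl) , λ y → y , lookup∘tabulate id y

    μ-exchange : F W → F X → F X′ → F V → F V′ →
      True (relational-iso? V′ V h) → Vec.map (col V) h ≡ tabulate (col V′) →
      comp W W V via-X one ≡ comp W V′ V h via-X′ →
      μ X V (tabulate suc) * μ W X (tabulate suc) ≈ μ X′ V′ (tabulate suc) * μ W X′ (tabulate suc)
    μ-exchange FW FX FX′ FV FV′ h-rel h-col eq = begin
      μ X V (tabulate suc) * μ W X (tabulate suc)
        ≈⟨ μ-comp W X V (tabulate suc) (tabulate suc) FW FX FV (old-emb W d r₁) (old-emb X e r) ⟨
      μ W V via-X
        ≈⟨ μ-square {W} {W} {V} {V′} {via-X} {via-X′} one h FW FW FV FV′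
             (comp-emb {X = W} {X} {V} {tabulate suc} {tabulate suc} (old-emb W d r₁) (old-emb X e r))
             (comp-emb {X = W} {X′} {V′} {tabulate suc} {tabulate suc} (old-emb W e r₀) (old-emb X′ d r′))
             one-iso (concrete-iso V′ V h h-rel h-col) eq ⟩
      μ W V′ via-X′
        ≈⟨ μ-comp W X′ V′ (tabulate suc) (tabulate suc) FW FX′ FV′ (old-emb W e r₀) (old-emb X′ d r′) ⟩
      μ X′ V′ (tabulate suc) * μ W X′ (tabulate suc) ∎

  edge₁-flip : ∀ a b c e → τ edge₁ a b c e ≈ τ edge₁ c b a e
  edge₁-flip a b c e = μ-relabel (Tripod a b c) (Tripod c b a) (attach edge₁) (attach edge₁) e (# 2 ∷ # 1 ∷ # 0 ∷ [])
    (tripod∈ a b c) (tripod∈ c b a) (edge₁∈ a b c e) (edge₁∈ c b a e) _ refl _ refl refl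

  edge₀-as-edge₁ : ∀ a b c e → τ edge₀ a b c e ≈ τ edge₁ b a c e
  edge₀-as-edge₁ a b c e = μ-relabel (Tripod a b c) (Tripod b a c) (attach edge₀) (attach edge₁) e (# 1 ∷ # 0 ∷ # 2 ∷ [])
    (tripod∈ a b c) (tripod∈ b a c) (edge₀∈ a b c e) (edge₁∈ b a c e) _ refl _ refl refl

  edge₂-as-edge₁ : ∀ a b c e → τ edge₂ a b c e ≈ τ edge₁ a c b e
  edge₂-as-edge₁ a b c e = μ-relabel (Tripod a b c) (Tripod a c b) (attach edge₂) (attach edge₁) e (# 0 ∷ # 2 ∷ # 1 ∷ [])
    (tripod∈ a b c) (tripod∈ a c b) (edge₂∈ a b c e) (edge₁∈ a c b e) _ refl _ refl refl

  at-b-swap : ∀ d a b c e → κ at-b d a b c e ≈ κ at-b a d b c e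
  at-b-swap d a b c e = μ-relabel (Quartet d a b c) (Quartet a d b c) (attach at-b) (attach at-b) e (# 1 ∷ # 0 ∷ # 2 ∷ # 3 ∷ [])
    (quartet∈ d a b c) (quartet∈ a d b c) (at-b∈ d a b c e) (at-b∈ a d b c e) _ refl _ refl refl

  at-a-as-at-b : ∀ d a b c e → κ at-a d a b c e ≈ κ at-b c b a d e
  at-a-as-at-b d a b c e = μ-relabel (Quartet d a b c) (Quartet c b a d) (attach at-a) (attach at-b) e (# 3 ∷ # 2 ∷ # 1 ∷ # 0 ∷ [])
    (quartet∈ d a b c) (quartet∈ c b a d) (at-a∈ d a b c e) (at-b∈ c b a d e) _ refl _ refl refl

  at-d-as-at-b : ∀ d a b c e → κ at-d d a b c e ≈ κ at-b c b d a e
  at-d-as-at-b d a b c e = μ-relabel (Quartet d a b c) (Quartet c b d a) (attach at-d) (attach at-b) e (# 3 ∷ # 2 ∷ # 0 ∷ # 1 ∷ [])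
    (quartet∈ d a b c) (quartet∈ c b d a) (at-d∈ d a b c e) (at-b∈ c b d a e) _ refl _ refl refl

  edge₁-as-at-b : ∀ d a b c e → τ edge₁ a b c e ≈ κ at-b d a b c e
  edge₁-as-at-b d a b c e = ≈-trans
    (μ-separate (tripod∈ a b c) (edge₁∈ a b c e) (quartet∈ d a b c) (at-b-profiles d a b c e)
      (inj₂ (# 0 , # 1 , # 2 , λ ())))
    (+-identityʳ _)

  edge₁-first : ∀ a a′ b c e → τ edge₁ a b c e ≈ τ edge₁ a′ b c e
  edge₁-first a a′ b c e = begin
    τ edge₁ a b c e    ≈⟨ edge₁-as-at-b a′ a b c e ⟩
    κ at-b a′ a b c e  ≈⟨ at-b-swap a′ a b c e ⟩
    κ at-b a a′ b c e  ≈⟨ edge₁-as-at-b a a′ b c e ⟨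
    τ edge₁ a′ b c e   ∎

  edge₁-colour : ∀ a a′ b c c′ e → τ edge₁ a b c e ≈ τ edge₁ a′ b c′ e
  edge₁-colour a a′ b c c′ e = begin
    τ edge₁ a b c e    ≈⟨ edge₁-first a c′ b c e ⟩
    τ edge₁ c′ b c e   ≈⟨ edge₁-flip c′ b c e ⟩
    τ edge₁ c b c′ e   ≈⟨ edge₁-first c a′ b c′ e ⟩
    τ edge₁ a′ b c′ e  ∎

  χ : Fin n → Fin n → Carrier
  χ a e = τ edge₁ a a a e

  edge₀-value : ∀ a b c e → τ edge₀ a b c e ≈ χ a e
  edge₀-value a b c e = ≈-trans (edge₀-as-edge₁ a b c e) (edge₁-colour b a a c a e)

  edge₁-value : ∀ a b c e → τ edge₁ a b c e ≈ χ b e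
  edge₁-value a b c e = edge₁-colour a b b c b e

  edge₂-value : ∀ a b c e → τ edge₂ a b c e ≈ χ c e
  edge₂-value a b c e = ≈-trans (edge₂-as-edge₁ a b c e) (edge₁-value a c b e)

  at-b-value : ∀ d a b c e → κ at-b d a b c e ≈ χ b e
  at-b-value d a b c e = ≈-trans (≈-sym (edge₁-as-at-b d a b c e)) (edge₁-value a b c e)

  at-a-value : ∀ d a b c e → κ at-a d a b c e ≈ χ a e
  at-a-value d a b c e = ≈-trans (at-a-as-at-b d a b c e) (at-b-value c b a d e)

  at-d-value : ∀ d a b c e → κ at-d d a b c e ≈ χ d e
  at-d-value d a b c e = ≈-trans (at-d-as-at-b d a b c e) (at-b-value c b d a e)

  swap-υ : ∀ a b d e → χ d e * υ d a b ≈ χ e d * υ e a b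
  swap-υ a b d e = begin
    χ d e * υ d a b             ≈⟨ *-congʳ (edge₀-value d a b e) ⟨
    τ edge₀ d a b e * υ d a b   ≈⟨ Exchange.μ-exchange (Pair a b) d e (attach []) (attach []) (attach edge₀) (attach edge₀)
                                     (pair∈ a b) (tripod∈ d a b) (tripod∈ e a b)
                                     (edge₀∈ d a b e) (edge₀∈ e a b d) _ refl refl ⟩
    τ edge₀ e a b d * υ e a b   ≈⟨ *-congʳ (edge₀-value e a b d) ⟩
    χ e d * υ e a b             ∎

  swap-χ : ∀ a d e → χ a e * χ a d ≈ κ inner e a a a d * χ a e
  swap-χ a d e = begin
    χ a e * χ a d                             ≈⟨ *-cong (at-a-value d a a a e) (edge₀-value a a a d) ⟨
    κ at-a d a a a e * τ edge₀ a a a d        ≈⟨ Exchange.μ-exchange (Tripod a a a) d e (attach edge₀) (attach edge₀) (attach at-a) (attach inner)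
                                                   (tripod∈ a a a) (quartet∈ d a a a) (quartet∈ e a a a)
                                                   (at-a∈ d a a a e) (inner∈ e a a a d) _ refl refl ⟩
    κ inner e a a a d * τ edge₀ a a a e       ≈⟨ *-congˡ (edge₀-value a a a e) ⟩
    κ inner e a a a d * χ a e                 ∎

  sum₄ : ∀ {p q r s p′ q′ r′ s′} → p ≈ p′ → q ≈ q′ → r ≈ r′ → s ≈ s′ →
         p + (q + (r + (s + 0#))) ≈ p′ + (q′ + (r′ + s′))
  sum₄ p q r s = +-cong p (+-cong q (+-cong r (≈-trans (+-identityʳ _) s)))

  module WithStars (star : ContainsTrees 4 F) where
    open Stars star

    centre₃-flip : ∀ a b c e → τ centre₃ a b c e ≈ τ centre₃ c b a e
    centre₃-flip a b c e = μ-relabel (Tripod a b c) (Tripod c b a) (attach centre₃) (attach centre₃) e (# 2 ∷ # 1 ∷ # 0 ∷ [])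
      (tripod∈ a b c) (tripod∈ c b a) (centre₃∈ a b c e) (centre₃∈ c b a e) _ refl _ refl refl

    centre₃-swap : ∀ a b c e → τ centre₃ a b c e ≈ τ centre₃ b a c e
    centre₃-swap a b c e = μ-relabel (Tripod a b c) (Tripod b a c) (attach centre₃) (attach centre₃) e (# 1 ∷ # 0 ∷ # 2 ∷ [])
      (tripod∈ a b c) (tripod∈ b a c) (centre₃∈ a b c e) (centre₃∈ b a c e) _ refl _ refl refl

    centre-bc-swap : ∀ d a b c e → κ centre-bc d a b c e ≈ κ centre-bc a d b c e
    centre-bc-swap d a b c e = μ-relabel (Quartet d a b c) (Quartet a d b c) (attach centre-bc) (attach centre-bc) e (# 1 ∷ # 0 ∷ # 2 ∷ # 3 ∷ [])
      (quartet∈ d a b c) (quartet∈ a d b c) (centre-bc∈ d a b c e) (centre-bc∈ a d b c e) _ refl _ refl refl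

    centre-da-as-centre-bc : ∀ d a b c e → κ centre-da d a b c e ≈ κ centre-bc c b a d e
    centre-da-as-centre-bc d a b c e = μ-relabel (Quartet d a b c) (Quartet c b a d) (attach centre-da) (attach centre-bc) e (# 3 ∷ # 2 ∷ # 1 ∷ # 0 ∷ [])
      (quartet∈ d a b c) (quartet∈ c b a d) (centre-da∈ d a b c e) (centre-bc∈ c b a d e) _ refl _ refl refl

    centre₃-as-centre-bc : ∀ d a b c e → τ centre₃ a b c e ≈ κ centre-bc d a b c e
    centre₃-as-centre-bc d a b c e = ≈-trans
      (μ-separate (tripod∈ a b c) (centre₃∈ a b c e) (quartet∈ d a b c) (centre-bc-profiles d a b c e star)
        (inj₂ (# 0 , # 1 , # 2 , λ ())))
      (+-identityʳ _)

    centre₃-first : ∀ a a′ b c e → τ centre₃ a b c e ≈ τ centre₃ a′ b c e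
    centre₃-first a a′ b c e = begin
      τ centre₃ a b c e       ≈⟨ centre₃-as-centre-bc a′ a b c e ⟩
      κ centre-bc a′ a b c e  ≈⟨ centre-bc-swap a′ a b c e ⟩
      κ centre-bc a a′ b c e  ≈⟨ centre₃-as-centre-bc a a′ b c e ⟨
      τ centre₃ a′ b c e      ∎

    ψ : Fin n → Carrier
    ψ e = τ centre₃ e e e e

    centre₃-value : ∀ a b c e → τ centre₃ a b c e ≈ ψ e
    centre₃-value a b c e = begin
      τ centre₃ a b c e  ≈⟨ centre₃-first a e b c e ⟩
      τ centre₃ e b c e  ≈⟨ centre₃-flip e b c e ⟩
      τ centre₃ c b e e  ≈⟨ centre₃-first c e b e e ⟩
      τ centre₃ e b e e  ≈⟨ centre₃-swap e b e e ⟩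
      τ centre₃ b e e e  ≈⟨ centre₃-first b e e e e ⟩
      τ centre₃ e e e e  ∎

    centre-da-value : ∀ d a b c e → κ centre-da d a b c e ≈ ψ e
    centre-da-value d a b c e = begin
      κ centre-da d a b c e  ≈⟨ centre-da-as-centre-bc d a b c e ⟩
      κ centre-bc c b a d e  ≈⟨ centre₃-as-centre-bc c b a d e ⟨
      τ centre₃ b a d e      ≈⟨ centre₃-value b a d e ⟩
      ψ e                    ∎

    relations : Relations R n
    relations = record
      { u = υ ; x = χ ; y = ψ ; v = λ d a e → κ inner d a a a e
      ; u-≢ = λ a b {d} {e} d≢e → ≈-trans
          (μ-separate (pair∈ a b) (tripod∈ e a b) (tripod∈ d a b) (star-tripod-profiles a b d e star) (inj₁ d≢e))
          (tripod-sum a b d e)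
      ; u-≡ = λ a b e → ≈-trans
          (μ-identified (pair∈ a b) (tripod∈ e a b) (tripod∈ e a b) (star-tripod-profiles a b e e star) refl (λ _ _ _ → refl))
          (+-congˡ (tripod-sum a b e e))
      ; x-≢ = λ a {d} {e} d≢e → ≈-trans (≈-sym (edge₀-value a a a e)) (≈-trans
          (μ-separate (tripod∈ a a a) (edge₀∈ a a a e) (quartet∈ d a a a) (star-quartet-profiles d a a a e star) (inj₁ d≢e))
          (quartet-sum d a e))
      ; x-≡ = λ a e → ≈-trans (≈-sym (edge₀-value a a a e)) (≈-trans
          (μ-identified (tripod∈ a a a) (edge₀∈ a a a e) (quartet∈ e a a a) (star-quartet-profiles e a a a e star) refl (λ _ _ _ → refl))
          (+-congˡ (quartet-sum e a e)))
      ; swap-u = swap-υ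
      ; swap-x = swap-χ
      }
      where
      tripod-sum : ∀ a b d e → τ centre₃ d a b e + (τ edge₀ d a b e + (τ edge₁ d a b e + (τ edge₂ d a b e + 0#)))
                               ≈ ψ e + (χ d e + (χ a e + χ b e))
      tripod-sum a b d e = sum₄ (centre₃-value d a b e) (edge₀-value d a b e) (edge₁-value d a b e) (edge₂-value d a b e)
      quartet-sum : ∀ d a e → κ centre-da d a a a e + (κ at-d d a a a e + (κ at-a d a a a e + (κ inner d a a a e + 0#)))
                              ≈ ψ e + (χ d e + (χ a e + κ inner d a a a e))
      quartet-sum d a e = sum₄ (centre-da-value d a a a e) (at-d-value d a a a e) (at-a-value d a a a e) ≈-refl

  resolved-relations : AllResolved F → Relations R n
  resolved-relations res = record
    { u = υ ; x = χ ; y = λ _ → 0# ; v = λ d a e → κ inner d a a a e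
    ; u-≢ = λ a b {d} {e} d≢e → ≈-trans
        (μ-separate (pair∈ a b) (tripod∈ e a b) (tripod∈ d a b) (resolved-tripod-profiles a b d e res) (inj₁ d≢e))
        (tripod-sum a b d e)
    ; u-≡ = λ a b e → ≈-trans
        (μ-identified (pair∈ a b) (tripod∈ e a b) (tripod∈ e a b) (resolved-tripod-profiles a b e e res) refl (λ _ _ _ → refl))
        (+-congˡ (tripod-sum a b e e))
    ; x-≢ = λ a {d} {e} d≢e → ≈-trans (≈-sym (edge₀-value a a a e)) (≈-trans
        (μ-separate (tripod∈ a a a) (edge₀∈ a a a e) (quartet∈ d a a a) (resolved-quartet-profiles d a a a e res) (inj₁ d≢e))
        (quartet-sum d a e))
    ; x-≡ = λ a e → ≈-trans (≈-sym (edge₀-value a a a e)) (≈-trans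
        (μ-identified (tripod∈ a a a) (edge₀∈ a a a e) (quartet∈ e a a a) (resolved-quartet-profiles e a a a e res) refl (λ _ _ _ → refl))
        (+-congˡ (quartet-sum e a e)))
    ; swap-u = swap-υ
    ; swap-x = swap-χ
    }
    where
    tripod-sum : ∀ a b d e → τ edge₀ d a b e + (τ edge₁ d a b e + (τ edge₂ d a b e + 0#)) ≈ 0# + (χ d e + (χ a e + χ b e))
    tripod-sum a b d e = ≈-trans (≈-sym (+-identityˡ _))
      (sum₄ ≈-refl (edge₀-value d a b e) (edge₁-value d a b e) (edge₂-value d a b e))
    quartet-sum : ∀ d a e → κ at-d d a a a e + (κ at-a d a a a e + (κ inner d a a a e + 0#))
                            ≈ 0# + (χ d e + (χ a e + κ inner d a a a e))
    quartet-sum d a e = ≈-trans (≈-sym (+-identityˡ _))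
      (sum₄ ≈-refl (at-d-value d a a a e) (at-a-value d a a a e) ≈-refl)

treeClass-trivial : ∀ {n} {F : Str n → Set} → 2 ≤ n → TreeClass F → ThetaTrivial F
treeClass-trivial {suc (suc n)} (s≤s (s≤s z≤n)) class R μ μ-measure =
  Collapse.1≈0 ([ WithStars.relations , resolved-relations ]′ (TreeClass.centres class)) {zero} {suc zero} λ ()
  where open Values class R μ μ-measure

CT-treeClass : ∀ n → TreeClass (CT n)
CT-treeClass n = record
  { quartets = λ (_ , _ , t) → quartetSystem t
  ; cubic    = λ t _ → _ , _ , t
  ; centres  = inj₁ λ t _ → _ , _ , t
  }

CTk-treeClass : ∀ n {k} → 3 ≤ k → TreeClass (CTk n k)
CTk-treeClass n {k} 3≤k = record
  { quartets = λ (_ , _ , t , _) → quartetSystem t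
  ; cubic    = λ t deg≤3 → _ , _ , t , λ u → ≤-trans (deg≤3 u) 3≤k
  ; centres  = centres
  }
  where
  centres : ContainsTrees 4 (CTk n k) ⊎ AllResolved (CTk n k)
  centres with m≤n⇒m<n∨m≡n 3≤k
  ... | inj₁ 4≤k  = inj₁ λ t deg≤4 → _ , _ , t , λ u → ≤-trans (deg≤4 u) 4≤k
  ... | inj₂ refl = inj₂ λ (_ , _ , t , deg≤3) → resolved t deg≤3

theorem3p2 : ∀ (n k : ℕ) → 2 ≤ n → 3 ≤ k
    → ThetaTrivial (CT n) × ThetaTrivial (CTk n k)
theorem3p2 n k 2≤n 3≤k =
  treeClass-trivial 2≤n (CT-treeClass n) , treeClass-trivial 2≤n (CTk-treeClass n 3≤k)
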